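{- There exists a linearly bounded graph of bounded degree which is not (isomorphic to) a rational graph.
   Context: Graphs. A $\Sigma$-labeled graph is a set $G\subseteq V\times\Sigma\times V$ with $\Sigma$ finite and $V$ countable; its set of vertices (support) is the set of all sources and targets of its edges. Two graphs $G,H$ are isomorphic if there is a bijection $\rho:V_H\to V_G$ with $(x,a,y)\in H$ iff $(\rho(x),a,\rho(y))\in G$. Bounded degree means that there is $k\in\mathbb N$ such that every vertex is the source or the target of at most $k$ edges. The empty word is denoted $\varepsilon$. Rational graphs. A finite transducer over $\Gamma$ is a finite automaton with labels in $(\Gamma\cup\{\varepsilon\})\times(\Gamma\cup\{\varepsilon\})$; it accepts a rational subset of $\Gamma^*\times\Gamma^*$, i.e. a binary relation on words, with which it is identified. A rational graph labeled by $\Sigma$ with vertices in $\Gamma^*$ is given by a family $(T_a)_{a\in\Sigma}$ of finite transducers over $\Gamma$: $(u,a,v)\in G$ iff $(u,v)\in T_a$. Labeled linearly bounded Turing machines (LLBMs). An LLBM is a tuple $M=(\Gamma,\Sigma,[,],Q,q_0,F,\delta)$ where $\Gamma$ is a finite set of tape symbols, $\Sigma\subseteq\Gamma$ is the input alphabet, $[,]\notin\Gamma$ are the left and right end-markers, $Q$ is a finite set of control states disjoint from $\Gamma$, $q_0\in Q$ is the initial state, $F\subseteq Q$ is the set of final states, and $\delta$ is a finite set of labeled rules of the forms $pA\xrightarrow{\varepsilon}qB\pm$, $p[\,\xrightarrow{\varepsilon}q[+$, $p]\xrightarrow{\varepsilon}q]-$, $pB\xrightarrow{a}qAB$, $p]\xrightarrow{a}qA]$,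 $pA\xrightarrow{\varepsilon}q$, with $p,q\in Q$, $A,B\in\Gamma$, $\pm\in\{+,-\}$, $a\in\Sigma$. A configuration is a word $uqv$ with $q\in Q$, $v\neq\varepsilon$ and $uv\in[\Gamma^*]$ (left marker, then a word over $\Gamma$, then right marker). For $x\in\Sigma\cup\{\varepsilon\}$ the relation $\xrightarrow{x}$ on configurations consists of the following pairs, where $X,Y\in\Gamma\cup\{[,]\}$: $upXv\xrightarrow{x}uYqv$ if $pX\xrightarrow{x}qY+\in\delta$; $uCpXv\xrightarrow{x}uqCYv$ if $pX\xrightarrow{x}qY-\in\delta$; $upAv\xrightarrow{\varepsilon}uqv$ if $pA\xrightarrow{\varepsilon}q\in\delta$; $upXv\xrightarrow{a}uqAXv$ if $pX\xrightarrow{a}qAX\in\delta$. Normalized LLBMs. $M$ is normalized if $Q$ is the disjoint union of $Q_\Sigma$ (external states) and $Q_\varepsilon$ (internal states) such that $F\subseteq Q_\Sigma$, every rule labeled by a letter of $\Sigma$ has its left-hand state $p$ in $Q_\Sigma$, every rule labeled by $\varepsilon$ has its left-hand state $p$ in $Q_\varepsilon$, and for every $p\in Q_\varepsilon$ and $X\in\Gamma\cup\{[,]\}$ there is a rule of the form $pX\xrightarrow{\varepsilon}qY\pm$ in $\delta$. A configuration is external if its control state is in $Q_\Sigma$. Linearly bounded graphs. The transition graph of a normalized LLBM $M$ is $G_M=\{(c,a,c')\mid a\in\Sigma,\ c,c' \text{ external configurations, } c\xrightarrow{a\varepsilon^*}c'\}$, where $c\xrightarrow{a\varepsilon^*}c'$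 means one $a$-transition followed by finitely many (possibly zero) $\varepsilon$-transitions. A linearly bounded graph is any graph isomorphic to the transition graph of some normalized LLBM. -}

module Defs where

open import Data.Nat.Base using (ℕ; zero; suc; _≤_)
open import Data.Nat.Properties using (suc-injective)
open import Data.Fin.Base using (Fin; toℕ)
open import Data.Fin.Properties using (toℕ-injective)
open import Data.Fin.Subset using (Subset) renaming (_∈_ to _∈ˢ_; _∉_ to _∉ˢ_)
open import Data.List.Base using (List; []; _∷_; [_]; _++_; _ʳ++_; _?∷_; map; length)
open import Data.List.Membership.Propositional using (_∈_)
open import Data.List.Relation.Unary.All using (All)
open import Data.List.Relation.Unary.Unique.Propositional using (Unique)
open import Data.Maybe.Base using (Maybe; just; nothing)
open import Data.Product.Base using (Σ; ∃; ∃-syntax; _×_; _,_; proj₁)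
open import Data.Sum.Base using (_⊎_)
open import Function.Bundles using (_↣_; _⇔_; mk↣; Injection; Bijection)
open import Level using (0ℓ)
open import Relation.Binary.Bundles using (Setoid)
open import Relation.Binary.Construct.Closure.ReflexiveTransitive using (Star)
import Relation.Binary.Construct.On as On
open import Relation.Binary.PropositionalEquality
  using (_≡_; _≢_; refl; sym; cong; cong₂; setoid)

double : ℕ → ℕ
double zero    = zero
double (suc n) = suc (suc (double n))

double-injective : ∀ m n → double m ≡ double n → m ≡ n
double-injective zero    zero    _  = refl
double-injective (suc m) (suc n) eq =
  cong suc (double-injective m n (suc-injective (suc-injective eq)))

double≢suc-double : ∀ m n → double m ≢ suc (double n)
double≢suc-double (suc m) (suc n) eq =
  double≢suc-double m n (suc-injective (suc-injective eq))

pair : ℕ → ℕ → ℕ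
pair zero    n = double n
pair (suc m) n = suc (double (pair m n))

pair-injective : ∀ m n m′ n′ → pair m n ≡ pair m′ n′ → m ≡ m′ × n ≡ n′
pair-injective zero    n zero     n′ eq = refl , double-injective n n′ eq
pair-injective zero    n (suc m′) n′ eq with () ← double≢suc-double n (pair m′ n′) eq
pair-injective (suc m) n zero     n′ eq
  with () ← double≢suc-double n′ (pair m n) (sym eq)
pair-injective (suc m) n (suc m′) n′ eq
  with refl , n≡n′ ← pair-injective m n m′ n′
         (double-injective (pair m n) (pair m′ n′) (suc-injective eq))
  = refl , n≡n′

codeList : {A : Set} → (A → ℕ) → List A → ℕ
codeList f []       = zero
codeList f (x ∷ xs) = suc (pair (f x) (codeList f xs))

codeList-injective : {A : Set} (f : A → ℕ) → (∀ {x y} → f x ≡ f y → x ≡ y) →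
                     ∀ xs ys → codeList f xs ≡ codeList f ys → xs ≡ ys
codeList-injective f inj []       []       _  = refl
codeList-injective f inj (x ∷ xs) (y ∷ ys) eq
  with fx≡fy , eq′ ← pair-injective (f x) _ (f y) _ (suc-injective eq)
  = cong₂ _∷_ (inj fx≡fy) (codeList-injective f inj xs ys eq′)

List-countable : {A : Set} → A ↣ ℕ → List A ↣ ℕ
List-countable A↣ℕ = mk↣ λ {xs} {ys} → codeList-injective to injective xs ys
  where open Injection A↣ℕ

Fin-countable : ∀ n → Fin n ↣ ℕ
Fin-countable n = mk↣ {to = toℕ} toℕ-injective

-- Finite alphabets and state sets are taken to be of the form Fin n
-- throughout.
record Graph (s : ℕ) : Set₁ where
  field
    V         : Set
    countable : V ↣ ℕ
    Edge      : V → Fin s → V → Set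

  Incident : V → V × Fin s × V → Set
  Incident x (y , a , z) = Edge y a z × (y ≡ x ⊎ z ≡ x)

  InSupport : V → Set
  InSupport x = ∃[ e ] Incident x e

  -- The vertices proper: elements of V that are the source or target of
  -- an edge.  Equality ignores which edge witnesses this.
  Support : Setoid 0ℓ 0ℓ
  Support = On.setoid {B = ∃ InSupport} (setoid V) proj₁

Isomorphic : ∀ {s} → Graph s → Graph s → Set
Isomorphic G H =
  Σ (Bijection (Graph.Support H) (Graph.Support G)) λ ρ →
    ∀ x a y → Graph.Edge H (proj₁ x) a (proj₁ y) ⇔
              Graph.Edge G (proj₁ (Bijection.to ρ x)) a (proj₁ (Bijection.to ρ y))

BoundedDegree : ∀ {s} → Graph s → Set
BoundedDegree G =
  ∃[ k ] ∀ x es → Unique es → All (Graph.Incident G x) es → length es ≤ k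

record Transducer (g : ℕ) : Set where
  field
    states         : ℕ
    initial final  : Subset states
    transitions    : List (Fin states × Maybe (Fin g) × Maybe (Fin g) × Fin states)

  data AcceptsFrom : Fin states → List (Fin g) → List (Fin g) → Set where
    stop : ∀ {p} → p ∈ˢ final → AcceptsFrom p [] []
    step : ∀ {p x y q u v} → (p , x , y , q) ∈ transitions →
           AcceptsFrom q u v → AcceptsFrom p (x ?∷ u) (y ?∷ v)

  Accepts : List (Fin g) → List (Fin g) → Set
  Accepts u v = ∃[ p ] p ∈ˢ initial × AcceptsFrom p u v

rationalGraph : ∀ {s g} → (Fin s → Transducer g) → Graph s
rationalGraph {g = g} T = record
  { V         = List (Fin g)
  ; countable = List-countable (Fin-countable g)
  ; Edge      = λ u a v → Transducer.Accepts (T a) u v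
  }

IsRational : ∀ {s} → Graph s → Set
IsRational {s} G = ∃[ g ] Σ (Fin s → Transducer g) λ T → Isomorphic G (rationalGraph T)

data Sym (g : ℕ) : Set where
  lmark rmark : Sym g
  tape        : Fin g → Sym g

data Dir : Set where
  + - : Dir

-- End-markers can be neither overwritten nor crossed.
data ShiftOK {g : ℕ} : Sym g → Sym g → Dir → Set where
  inner   : ∀ A B d → ShiftOK (tape A) (tape B) d
  atLeft  : ShiftOK lmark lmark +
  atRight : ShiftOK rmark rmark -

-- Insertion happens just left of X, hence never before the left marker.
data InsertOK {g : ℕ} : Sym g → Set where
  inner   : ∀ B → InsertOK (tape B)
  atRight : InsertOK rmark

data Rule (s g n : ℕ) : Set where
  shift  : (p : Fin n) (X : Sym g) (q : Fin n) (Y : Sym g) (d : Dir) →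
           ShiftOK X Y d → Rule s g n
  insert : (p : Fin n) (X : Sym g) (a : Fin s) (q : Fin n) (A : Fin g) →
           InsertOK X → Rule s g n
  delete : (p : Fin n) (A : Fin g) (q : Fin n) → Rule s g n

lhsState : ∀ {s g n} → Rule s g n → Fin n
lhsState (shift p _ _ _ _ _)  = p
lhsState (insert p _ _ _ _ _) = p
lhsState (delete p _ _)       = p

label : ∀ {s g n} → Rule s g n → Maybe (Fin s)
label (shift _ _ _ _ _ _)  = nothing
label (insert _ _ a _ _ _) = just a
label (delete _ _ _)       = nothing

-- The word u q v is stored as ⟨ uʳ , q , v ⟩ with uʳ the reversal of u, so
-- that both lists start next to the head.
record Config (g n : ℕ) : Set where
  constructor ⟨_,_,_⟩
  field
    leftʳ : List (Sym g)
    state : Fin n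
    right : List (Sym g)

IsConfig : ∀ {g n} → Config g n → Set
IsConfig ⟨ uʳ , q , v ⟩ =
  v ≢ [] × ∃[ w ] uʳ ʳ++ v ≡ lmark ∷ map tape w ++ [ rmark ]

record LLBM (s : ℕ) : Set where
  field
    g      : ℕ
    input  : Fin s ↣ Fin g
    n      : ℕ
    q₀     : Fin n
    F      : Subset n
    δ      : List (Rule s g n)

  data Rewrites : Maybe (Fin s) → Config g n → Config g n → Set where
    shift+  : ∀ {u p X v q Y ok} → shift p X q Y + ok ∈ δ →
              Rewrites nothing ⟨ u , p , X ∷ v ⟩ ⟨ Y ∷ u , q , v ⟩
    shift-  : ∀ {u C p X v q Y ok} → shift p X q Y - ok ∈ δ →
              Rewrites nothing ⟨ C ∷ u , p , X ∷ v ⟩ ⟨ u , q , C ∷ Y ∷ v ⟩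
    delete  : ∀ {u p A v q} → delete p A q ∈ δ →
              Rewrites nothing ⟨ u , p , tape A ∷ v ⟩ ⟨ u , q , v ⟩
    insert  : ∀ {u p X v a q A ok} → insert p X a q A ok ∈ δ →
              Rewrites (just a) ⟨ u , p , X ∷ v ⟩ ⟨ u , q , tape A ∷ X ∷ v ⟩

  Transition : Maybe (Fin s) → Config g n → Config g n → Set
  Transition x c c′ = IsConfig c × IsConfig c′ × Rewrites x c c′

record NormalizedLLBM (s : ℕ) : Set where
  field
    llbm : LLBM s

  open LLBM llbm public

  -- The internal states are the complement of QΣ.
  field
    QΣ               : Subset n
    final-external   : ∀ {p} → p ∈ˢ F → p ∈ˢ QΣ
    letter-external  : ∀ {r a} → r ∈ δ → label r ≡ just a → lhsState r ∈ˢ QΣ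
    ε-internal       : ∀ {r} → r ∈ δ → label r ≡ nothing → lhsState r ∉ˢ QΣ
    internal-total   : ∀ {p} → p ∉ˢ QΣ → ∀ X →
                       ∃[ q ] ∃[ Y ] ∃[ d ] ∃[ ok ] shift p X q Y d ok ∈ δ

  External : Config g n → Set
  External c = IsConfig c × Config.state c ∈ˢ QΣ

codeSym : ∀ {g} → Sym g → ℕ
codeSym lmark    = 0
codeSym rmark    = 1
codeSym (tape A) = suc (suc (toℕ A))

codeSym-injective : ∀ {g} {X Y : Sym g} → codeSym X ≡ codeSym Y → X ≡ Y
codeSym-injective {X = lmark}  {lmark}  _  = refl
codeSym-injective {X = rmark}  {rmark}  _  = refl
codeSym-injective {X = tape A} {tape B} eq =
  cong tape (toℕ-injective (suc-injective (suc-injective eq)))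

Config-countable : ∀ g n → Config g n ↣ ℕ
Config-countable g n = mk↣ {to = code} code-injective
  where
  open Injection (List-countable (mk↣ (codeSym-injective {g})))

  code : Config g n → ℕ
  code ⟨ u , q , v ⟩ = pair (to u) (pair (toℕ q) (to v))

  code-injective : ∀ {c c′} → code c ≡ code c′ → c ≡ c′
  code-injective {⟨ u , q , v ⟩} {⟨ u′ , q′ , v′ ⟩} eq
    with eq₁ , eq₂₃ ← pair-injective (to u) _ (to u′) _ eq
    with eq₂ , eq₃ ← pair-injective (toℕ q) _ (toℕ q′) _ eq₂₃
    with refl ← injective {u} {u′} eq₁
       | refl ← toℕ-injective {i = q} {q′} eq₂
       | refl ← injective {v} {v′} eq₃
    = refl

transitionGraph : ∀ {s} → NormalizedLLBM s → Graph s
transitionGraph M = record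
  { V         = Config g n
  ; countable = Config-countable g n
  ; Edge      = λ c a c′ → External c × External c′ ×
                  ∃[ d ] Transition (just a) c d × Star (Transition nothing) d c′
  }
  where open NormalizedLLBM M

IsLinearlyBounded : ∀ {s} → Graph s → Set
IsLinearlyBounded {s} G = Σ (NormalizedLLBM s) λ M → Isomorphic G (transitionGraph M)

{-# OPTIONS --safe #-}
-- For a word w over the labels let L(w) be the set of vertices from which a
-- path labelled w starts.
--
-- In a rational graph L(w) is recognized by an automaton with at most c^|w|
-- states, c depending only on the transducers, because the preimage of a
-- recognizable language under a transducer is recognizable.  By pumping, if
-- L(w) is finite then it contains only words shorter than this bound, so its
-- size is at most doubly exponential in |w|.
--
-- A linearly bounded machine has no such limitation: below, L(mark tallyⁿ launch)
-- is finite, but triply exponential in n.  Its elements are the words over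
-- {X₀, X₁, Y} in which the number of Ys is less than 2^(n+2) and the number of Xs
-- is less than 2^(number of Ys).  The edges labelled mark and tally only insert
-- a Z; the edge labelled launch checks the two inequalities by repeatedly spending
-- one token and halving the remaining targets, first with the Zs as tokens and
-- the Ys as targets, then with the Ys as tokens and the Xs as targets.  The
-- machine is deterministic and no edge destroys information, so the graph has
-- bounded degree.

module Submission where

open import Defs renaming (+ to rightward; - to leftward)
open import Data.Bool.Base using (Bool; true; false; if_then_else_)
open import Data.Empty using (⊥)
open import Data.Fin.Base using (Fin; zero; suc; toℕ; combine; remQuot; _↑ˡ_)
open import Data.Fin.Patterns
open import Data.Fin.Properties
  using (suc-injective; toℕ-injective; ↑ˡ-injective; combine-injective; combine-remQuot;
         injective⇒≤; pigeonhole)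
open import Data.Fin.Subset using (Subset; inside) renaming (_∈_ to _∈ˢ_; _∉_ to _∉ˢ_; ⊥ to ∅)
open import Data.Fin.Subset.Properties using (∉⊥; drop-there)
open import Data.List.Base
  using (List; []; _∷_; [_]; _++_; _ʳ++_; _?∷_; map; reverse; length; lookup; replicate; foldr;
         cartesianProductWith; allFin)
open import Data.List.Membership.Propositional using (_∈_)
open import Data.List.Membership.Propositional.Properties
  using (∈-cartesianProductWith⁺; ∈-cartesianProductWith⁻; ∈-allFin; ∈-map⁺; ∈-lookup)
open import Data.List.Properties
  using (length-++; length-replicate; ++-cancelʳ; ++-ʳ++; ∷-injective; map-∘; map-injective;
         map-ʳ++; reverse-map; reverse-injective; reverse-involutive; unfold-reverse; ʳ++-defn)
open import Data.List.Relation.Unary.All as All using (All; []; _∷_)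
open import Data.List.Relation.Unary.All.Properties using (replicate⁺)
open import Data.List.Relation.Unary.AllPairs using ([]; _∷_)
open import Data.List.Relation.Unary.Any using (here; there)
open import Data.List.Relation.Unary.Unique.Propositional using (Unique)
open import Data.Maybe.Base using (Maybe; just; nothing; maybe′)
open import Data.Nat.Base
  using (ℕ; zero; suc; _+_; _*_; _^_; _≤_; _<_; s≤s; z≤n; ⌊_/2⌋; ⌈_/2⌉)
open import Data.Nat.Properties hiding (suc-injective)
open import Data.Product.Base using (Σ; ∃-syntax; _×_; _,_; proj₁; proj₂)
open import Data.Sum.Base using (_⊎_; inj₁; inj₂)
open import Data.Unit.Base using (⊤; tt)
open import Data.Vec.Base as Vec using ([]; _∷_; here; there)
open import Function.Base using (case_of_)
open import Function.Bundles using (_⇔_; mk⇔; mk↣; Equivalence; Bijection)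
open import Function.Construct.Identity using (bijection)
open import Function.Definitions using (Injective)
open import Relation.Binary.Construct.Closure.ReflexiveTransitive using (Star; ε; _◅_; _◅◅_)
open import Relation.Binary.PropositionalEquality
  using (_≡_; refl; sym; trans; cong; cong₂; subst; subst₂; module ≡-Reasoning)
open import Relation.Nullary using (¬_; contradiction)

-- Words, automata and traces

-- The list becomes `N` digits in base `suc g`, the digit zero being padding. Longer lists are
-- truncated, whence the length bounds for injectivity.
listIndex : ∀ {g} N → List (Fin g) → Fin (suc g ^ N)
listIndex     zero    _        = zero
listIndex {g} (suc N) []       = combine {suc g} zero (listIndex N [])
listIndex {g} (suc N) (A ∷ xs) = combine {suc g} (suc A) (listIndex N xs)

listIndex-injective : ∀ {g} N {xs ys : List (Fin g)} → length xs ≤ N → length ys ≤ N →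
                      listIndex N xs ≡ listIndex N ys → xs ≡ ys
listIndex-injective zero    {[]}     {[]}     _ _ _ = refl
listIndex-injective (suc N) {[]}     {[]}     _ _ _ = refl
listIndex-injective {g} (suc N) {[]}     {B ∷ ys} _ _ eq
  with () ← proj₁ (combine-injective {suc g} zero (listIndex N []) (suc B) (listIndex N ys) eq)
listIndex-injective {g} (suc N) {A ∷ xs} {[]}     _ _ eq
  with () ← proj₁ (combine-injective {suc g} (suc A) (listIndex N xs) zero (listIndex N []) eq)
listIndex-injective {g} (suc N) {A ∷ xs} {B ∷ ys} (s≤s xs≤) (s≤s ys≤) eq
  with A≡B , eq′ ← combine-injective {suc g} (suc A) (listIndex N xs) (suc B) (listIndex N ys) eq
  = cong₂ _∷_ (suc-injective A≡B) (listIndex-injective N xs≤ ys≤ eq′)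

countShortLists : ∀ {g M} N (f : Fin M → List (Fin g)) → Injective _≡_ _≡_ f →
                  (∀ i → length (f i) ≤ N) → M ≤ suc g ^ N
countShortLists N f f-injective f≤N = injective⇒≤ {f = λ i → listIndex N (f i)} λ {i} {j} eq →
  f-injective (listIndex-injective N (f≤N i) (f≤N j) eq)

-- Any type injecting into `Fin size` may serve as the states, so that products need no recoding;
-- pumping depends only on the bound `size`.
record Automaton (g : ℕ) : Set₁ where
  field
    State           : Set
    size            : ℕ
    index           : State → Fin size
    index-injective : ∀ {p q} → index p ≡ index q → p ≡ q
    Step            : State → Maybe (Fin g) → State → Set
    Initial Final   : State → Set

  data Run : State → List (Fin g) → State → Set where
    []     : ∀ {p} → Run p [] p
    silent : ∀ {p q r u} → Step p nothing q → Run q u r → Run p u r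
    letter : ∀ {p q r A u} → Step p (just A) q → Run q u r → Run p (A ∷ u) r

  Recognizes : List (Fin g) → Set
  Recognizes u = ∃[ p ] ∃[ q ] Initial p × Run p u q × Final q

  _++ᴿ_ : ∀ {p q r u v} → Run p u q → Run q v r → Run p (u ++ v) r
  []         ++ᴿ σ = σ
  silent s ρ ++ᴿ σ = silent s (ρ ++ᴿ σ)
  letter s ρ ++ᴿ σ = letter s (ρ ++ᴿ σ)

  -- Positions count letters, not steps: silent steps are passed over, so two distinct positions
  -- always enclose a nonempty factor.
  stateAt : ∀ {p u r} → Run p u r → Fin (suc (length u)) → State
  stateAt {p} _        zero    = p
  stateAt (silent _ ρ) (suc i) = stateAt ρ (suc i)
  stateAt (letter _ ρ) (suc i) = stateAt ρ i

  runBefore : ∀ {p u r} (ρ : Run p u r) i → ∃[ v ] Run p v (stateAt ρ i)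
  runBefore _            zero    = _ , []
  runBefore (silent s ρ) (suc i) = _ , silent s (proj₂ (runBefore ρ (suc i)))
  runBefore (letter s ρ) (suc i) = _ , letter s (proj₂ (runBefore ρ i))

  runAfter : ∀ {p u r} (ρ : Run p u r) i → ∃[ v ] Run (stateAt ρ i) v r
  runAfter ρ            zero    = _ , ρ
  runAfter (silent _ ρ) (suc i) = runAfter ρ (suc i)
  runAfter (letter _ ρ) (suc i) = runAfter ρ i

  runBetween : ∀ {p u r} (ρ : Run p u r) {i j} → toℕ i < toℕ j →
               ∃[ A ] ∃[ v ] Run (stateAt ρ i) (A ∷ v) (stateAt ρ j)
  runBetween []           {zero}  {zero}  ()
  runBetween (silent s ρ) {zero}  {suc j} i<j
    with A , v , σ ← runBetween ρ {zero} {suc j} i<j = A , v , silent s σ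
  runBetween (letter s ρ) {zero}  {suc j} i<j = _ , _ , letter s (proj₂ (runBefore ρ j))
  runBetween (silent s ρ) {suc i} {suc j} i<j = runBetween ρ {suc i} {suc j} i<j
  runBetween (letter s ρ) {suc i} {suc j} (s≤s i<j) = runBetween ρ i<j

  -- The word has more positions than there are states, so some state occurs at two positions and
  -- the factor between them can be repeated.
  pumping : ∀ {u} → Recognizes u → size ≤ length u →
            Σ (ℕ → List (Fin g)) λ f → Injective _≡_ _≡_ f × (∀ k → Recognizes (f k))
  pumping {u} (p , r , p∈I , ρ , r∈F) size≤∣u∣
    with i , j , i<j , same ← pigeonhole (s≤s size≤∣u∣) (λ i → index (stateAt ρ i))
    with x , before ← runBefore ρ i
       | A , y , between ← runBetween ρ i<j
       | z , after ← runAfter ρ j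
    -- Identifying the two states turns `between` into a loop at `stateAt ρ i`.
    rewrite sym (index-injective same)
    = (λ k → x ++ loop k) , injective , λ k → p , r , p∈I , before ++ᴿ runLoop k , r∈F
    where
    loop : ℕ → List (Fin g)
    loop zero    = z
    loop (suc k) = A ∷ y ++ loop k

    runLoop : ∀ k → Run (stateAt ρ i) (loop k) r
    runLoop zero    = after
    runLoop (suc k) = between ++ᴿ runLoop k

    length-loop : ∀ k → length (loop k) ≡ k * suc (length y) + length z
    length-loop zero    = refl
    length-loop (suc k) = cong suc (begin
      length (y ++ loop k)                            ≡⟨ length-++ y ⟩
      length y + length (loop k)                      ≡⟨ cong (length y +_) (length-loop k) ⟩
      length y + (k * suc (length y) + length z)      ≡⟨ +-assoc (length y) _ _ ⟨
      length y + k * suc (length y) + length z        ∎)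
      where open ≡-Reasoning

    injective : Injective _≡_ _≡_ (λ k → x ++ loop k)
    injective {k} {l} eq =
      -- Lengths alone tell the words apart: each turn of the loop adds the positive number
      -- `suc (length y)`.
      *-cancelʳ-≡ k l (suc (length y)) (+-cancelʳ-≡ (length z) _ _ (begin
        k * suc (length y) + length z ≡⟨ length-loop k ⟨
        length (loop k)               ≡⟨ +-cancelˡ-≡ (length x) _ _ (begin
          length x + length (loop k)    ≡⟨ length-++ x ⟨
          length (x ++ loop k)          ≡⟨ cong length eq ⟩
          length (x ++ loop l)          ≡⟨ length-++ x ⟩
          length x + length (loop l)    ∎) ⟩
        length (loop l)               ≡⟨ length-loop l ⟩
        l * suc (length y) + length z ∎))
      where open ≡-Reasoning

universal : ∀ g → Automaton g
universal g = record
  { State = ⊤ ; size = 1 ; index = λ _ → zero ; index-injective = λ _ → refl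
  ; Step = λ _ _ _ → ⊤ ; Initial = λ _ → ⊤ ; Final = λ _ → ⊤ }

universal-recognizes : ∀ {g} (u : List (Fin g)) → Automaton.Recognizes (universal g) u
universal-recognizes u = tt , tt , tt , run u , tt
  where
  open Automaton (universal _)
  run : ∀ u → Run tt u tt
  run []      = []
  run (A ∷ u) = letter tt (run u)

-- Preimages under transducers

module _ {g} (T : Transducer g) (𝒜 : Automaton g) where
  private
    module T = Transducer T
    module 𝒜 = Automaton 𝒜

  -- A product construction: the label is what the transducer reads, and the letter it writes is
  -- consumed by `𝒜`. When no letter is passed on, either component moves alone.
  data PreimageStep : Fin T.states × 𝒜.State → Maybe (Fin g) → Fin T.states × 𝒜.State → Set where
    emit   : ∀ {p x A q i j} → (p , x , just A , q) ∈ T.transitions → 𝒜.Step i (just A) j →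
             PreimageStep (p , i) x (q , j)
    idle   : ∀ {p x q i} → (p , x , nothing , q) ∈ T.transitions →
             PreimageStep (p , i) x (q , i)
    silent : ∀ {p i j} → 𝒜.Step i nothing j → PreimageStep (p , i) nothing (p , j)

  preimage : Automaton g
  preimage = record
    { State = Fin T.states × 𝒜.State
    ; size  = T.states * 𝒜.size
    ; index = λ (p , i) → combine p (𝒜.index i)
    ; index-injective = λ {(p , i)} {(q , j)} eq →
        let p≡q , i≡j = combine-injective p (𝒜.index i) q (𝒜.index j) eq
        in cong₂ _,_ p≡q (𝒜.index-injective i≡j)
    ; Step    = PreimageStep
    ; Initial = λ (p , i) → p ∈ˢ T.initial × 𝒜.Initial i
    ; Final   = λ (p , i) → p ∈ˢ T.final × 𝒜.Final i
    }

  private module 𝒫 = Automaton preimage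

  private
    read : ∀ {s x t r u} → PreimageStep s x t → 𝒫.Run t u r → 𝒫.Run s (x ?∷ u) r
    read {x = nothing} = 𝒫.silent
    read {x = just _}  = 𝒫.letter

    -- The runs are interleaved: a transition writing nothing is taken at once; before one that
    -- writes a letter, `𝒜` makes its silent steps until it reads that letter.
    product : ∀ {p i j u v} → T.AcceptsFrom p u v → 𝒜.Run i v j →
              ∃[ q ] q ∈ˢ T.final × 𝒫.Run (p , i) u (q , j)
    product (T.stop p∈F) 𝒜.[] = _ , p∈F , 𝒫.[]
    product α@(T.stop _) (𝒜.silent s ρ)
      with q , q∈F , σ ← product α ρ = q , q∈F , 𝒫.silent (silent s) σ
    product (T.step {y = nothing} t α) ρ
      with q , q∈F , σ ← product α ρ = q , q∈F , read (idle t) σ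
    product α@(T.step {y = just _} _ _) (𝒜.silent s ρ)
      with q , q∈F , σ ← product α ρ = q , q∈F , 𝒫.silent (silent s) σ
    product (T.step {y = just _} t α) (𝒜.letter s ρ)
      with q , q∈F , σ ← product α ρ = q , q∈F , read (emit t s) σ

    unread : ∀ {x p q i j u} → PreimageStep (p , i) x (q , j) →
             ∃[ v ] T.AcceptsFrom q u v × ∃[ r ] 𝒜.Run j v r × 𝒜.Final r →
             ∃[ v ] T.AcceptsFrom p (x ?∷ u) v × ∃[ r ] 𝒜.Run i v r × 𝒜.Final r
    unread (emit t s) (v , α , r , ρ , r∈F) = _ , T.step t α , r , 𝒜.letter s ρ , r∈F
    unread (idle t)    (v , α , r , ρ , r∈F) = _ , T.step t α , r , ρ , r∈F
    unread (silent s)  (v , α , r , ρ , r∈F) = _ , α , r , 𝒜.silent s ρ , r∈F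

    project : ∀ {s u t} → 𝒫.Run s u t → 𝒫.Final t →
              ∃[ v ] T.AcceptsFrom (proj₁ s) u v × ∃[ r ] 𝒜.Run (proj₂ s) v r × 𝒜.Final r
    project 𝒫.[]           (p∈F , i∈F) = [] , T.stop p∈F , _ , 𝒜.[] , i∈F
    project (𝒫.silent s ρ) t∈F = unread s (project ρ t∈F)
    project (𝒫.letter s ρ) t∈F = unread s (project ρ t∈F)

  preimage-recognizes : ∀ {u} → 𝒫.Recognizes u ⇔ (∃[ v ] T.Accepts u v × 𝒜.Recognizes v)
  preimage-recognizes = mk⇔
    (λ ((p , i) , (q , j) , (p∈I , i∈I) , ρ , F) →
      let v , α , r , σ , r∈F = project ρ F
      in v , (p , p∈I , α) , i , r , i∈I , σ , r∈F)
    (λ (v , (p , p∈I , α) , i , j , i∈I , ρ , j∈F) →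
      let q , q∈F , σ = product α ρ
      in (p , i) , (q , j) , (p∈I , i∈I) , σ , (q∈F , j∈F))

-- Paths with a given label, and their transport along isomorphisms

Trace : ∀ {s} (G : Graph s) → Graph.V G → List (Fin s) → Set
Trace G x []      = ⊤
Trace G x (a ∷ w) = ∃[ y ] Graph.Edge G x a y × Trace G y w

-- The sources of paths labelled `a ∷ w` form the preimage under `T a` of the sources of paths
-- labelled `w`, so every letter multiplies the size by one state count.
traceAutomaton : ∀ {s g} → (Fin s → Transducer g) → List (Fin s) → Automaton g
traceAutomaton T = foldr (λ a → preimage (T a)) (universal _)

traceAutomaton-recognizes : ∀ {s g} (T : Fin s → Transducer g) w {u} →
  Automaton.Recognizes (traceAutomaton T w) u ⇔ Trace (rationalGraph T) u w
traceAutomaton-recognizes T []      {u} = mk⇔ (λ _ → tt) (λ _ → universal-recognizes u)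
traceAutomaton-recognizes T (a ∷ w) {u} = mk⇔
  (λ ρ → let v , e , σ = to ρ in v , e , Equivalence.to ih σ)
  (λ (v , e , τ) → from (v , e , Equivalence.from ih τ))
  where
  open Equivalence (preimage-recognizes (T a) (traceAutomaton T w) {u})
  ih : ∀ {v} → _
  ih {v} = traceAutomaton-recognizes T w {v}

module _ {s} {G H : Graph s} (G≅H : Isomorphic G H) where
  private
    module G = Graph G
    module H = Graph H
    ρ = proj₁ G≅H
    open Bijection ρ using (to; injective; strictlySurjective)

    source : ∀ (K : Graph s) {x a y} → Graph.Edge K x a y → Graph.InSupport K x
    source K e = _ , e , inj₁ refl

    target : ∀ (K : Graph s) {x a y} → Graph.Edge K x a y → Graph.InSupport K y
    target K e = _ , e , inj₂ refl

  trace-to : ∀ w u → Trace H (proj₁ u) w → Trace G (proj₁ (to u)) w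
  trace-to []      u _ = tt
  trace-to (a ∷ w) u (v , e , τ) =
    _ , Equivalence.to (proj₂ G≅H u a (v , target H e)) e , trace-to w (v , target H e) τ

  trace-from : ∀ w u → Trace G (proj₁ (to u)) w → Trace H (proj₁ u) w
  trace-from []      u _ = tt
  trace-from (a ∷ w) u (y , e , τ)
    with v , refl ← strictlySurjective (y , target G e)
    = proj₁ v , Equivalence.from (proj₂ G≅H u a v) e , trace-from w v τ

  -- The label is nonempty because an isomorphism relates only supports: the first edge puts the
  -- source into the support.
  traceSource-to : ∀ a w → Σ H.V (λ u → Trace H u (a ∷ w)) → Σ G.V λ x → Trace G x (a ∷ w)
  traceSource-to a w (u , τ@(v , e , _)) = _ , trace-to (a ∷ w) (u , source H e) τ

  traceSource-from : ∀ a w → Σ G.V (λ x → Trace G x (a ∷ w)) → Σ H.V λ u → Trace H u (a ∷ w)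
  traceSource-from a w (x , τ@(y , e , _))
    with u , refl ← strictlySurjective (x , source G e) = proj₁ u , trace-from (a ∷ w) u τ

  traceSource-to-injective : ∀ a w {u v} →
    proj₁ (traceSource-to a w u) ≡ proj₁ (traceSource-to a w v) → proj₁ u ≡ proj₁ v
  traceSource-to-injective a w {u , _ , e , _} {v , _ , f , _} = injective

  traceSource-from-injective : ∀ a w {x y} →
    proj₁ (traceSource-from a w x) ≡ proj₁ (traceSource-from a w y) → proj₁ x ≡ proj₁ y
  traceSource-from-injective a w {x , _ , e , _} {y , _ , f , _} eq
    with strictlySurjective (x , source G e) | strictlySurjective (y , source G f)
  ... | u , refl | v , refl = Bijection.cong ρ eq

-- The machine

count : {A : Set} → (A → Bool) → List A → ℕ
count P []      = 0
count P (x ∷ w) = if P x then suc (count P w) else count P w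

count-ʳ++ : {A : Set} (P : A → Bool) (l {r} : List A) → count P (l ʳ++ r) ≡ count P l + count P r
count-ʳ++ P []          = refl
count-ʳ++ P (x ∷ l) {r} = trans (count-ʳ++ P l) (shunt (P x))
  where
  shunt : ∀ b → count P l + (if b then suc (count P r) else count P r) ≡
                (if b then suc (count P l) else count P l) + count P r
  shunt true  = +-suc (count P l) (count P r)
  shunt false = refl

count-map : {A B : Set} (P : B → Bool) (f : A → B) (w : List A) →
            count P (map f w) ≡ count (λ x → P (f x)) w
count-map P f []      = refl
count-map P f (x ∷ w) rewrite count-map P f w = refl

-- A primed letter is a spent copy of the unprimed one.
Letter : Set
Letter = Fin 8

pattern X₀  = 0F
pattern X₁  = 1F
pattern Y   = 2F
pattern Z   = 3F
pattern X₀′ = 4F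
pattern X₁′ = 5F
pattern Y′  = 6F
pattern Z′  = 7F

toggle : Letter → Letter
toggle X₀  = X₀′
toggle X₁  = X₁′
toggle Y   = Y′
toggle Z   = Z′
toggle X₀′ = X₀
toggle X₁′ = X₁
toggle Y′  = Y
toggle Z′  = Z

-- Forgets which letters are spent. Toggling leaves it unchanged, so a word that starts out unprimed
-- can be read off the final tape.
revive : Letter → Letter
revive X₀′ = X₀
revive X₁′ = X₁
revive Y′  = Y
revive Z′  = Z
revive A   = A

live : Letter → Bool
live X₀′ = false
live X₁′ = false
live Y′  = false
live Z′  = false
live _   = true

fresh : Letter → Bool
fresh Z = false
fresh A = live A

data Phase : Set where
  y-phase x-phase : Phase

-- The Ys spent as targets in the first phase are the tokens of the second,
-- where they are turned back into Ys.
token : Phase → Letter → Bool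
token y-phase Z  = true
token x-phase Y′ = true
token _       _  = false

target : Phase → Letter → Bool
target y-phase Y  = true
target x-phase X₀ = true
target x-phase X₁ = true
target _       _  = false

token-toggle : ∀ φ A → token φ A ≡ true →
               token φ (toggle A) ≡ false × target φ (toggle A) ≡ target φ A
token-toggle y-phase Z  refl = refl , refl
token-toggle x-phase Y′ refl = refl , refl

target-toggle : ∀ φ A → target φ A ≡ true →
                target φ (toggle A) ≡ false × token φ (toggle A) ≡ token φ A
target-toggle y-phase Y  refl = refl , refl
target-toggle x-phase X₀ refl = refl , refl
target-toggle x-phase X₁ refl = refl , refl

revive-toggle : ∀ A → revive (toggle A) ≡ revive A
revive-toggle X₀  = refl
revive-toggle X₁  = refl
revive-toggle Y   = refl
revive-toggle Z   = refl
revive-toggle X₀′ = refl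
revive-toggle X₁′ = refl
revive-toggle Y′  = refl
revive-toggle Z′  = refl

-- The two checks ensure that the word before a launch is determined by the word
-- after it: all letters are unprimed, and the head is at the leftmost Z.
data Internal : Set where
  start checkLeft checkRight      : Internal
  sink                            : Dir → Internal
  seek advance clear odd even     : Phase → Internal

direction : Internal → Dir
direction start       = leftward
direction checkLeft   = leftward
direction checkRight  = rightward
direction (sink d)    = d
direction (seek _)    = rightward
direction (advance _) = rightward
direction (clear _)   = leftward
direction (odd _)     = leftward
direction (even _)    = leftward

-- `start` steps off the inserted Z, which `checkLeft` would reject. In a leftward sweep of a phase,
-- `odd` and `even` hold the parity of the number of targets met, and `clear` means that none has
-- been met.
next : Internal → Letter → Internal
next start       _ = checkLeft
next checkLeft   A = if fresh A then checkLeft else sink leftward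
next checkRight  A = if live A then checkRight else sink rightward
next (sink d)    _ = sink d
next (seek φ)    A = if token φ A then advance φ else seek φ
next (advance φ) _ = advance φ
next (clear φ)   A = if target φ A then odd φ else clear φ
next (odd φ)     A = if target φ A then even φ else odd φ
next (even φ)    A = if target φ A then odd φ else even φ

-- Every other target is spent, beginning with the first: halving rounds down, and a single target
-- disappears.
write : Internal → Letter → Letter
write (seek φ)  A = if token φ A then toggle A else A
write (clear φ) A = if target φ A then toggle A else A
write (even φ)  A = if target φ A then toggle A else A
write _         A = A

opposite : Dir → Dir
opposite rightward = leftward
opposite leftward  = rightward

-- The state entered at an end-marker; `nothing` stands for acceptance. A `seek` arriving there
-- found no token to pay for the halving just made, and sinks. Sinks bounce forever, since an
-- internal state must have a rule for every symbol.
turn : Internal → Maybe Internal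
turn start           = just (sink rightward)
turn checkLeft       = just checkRight
turn checkRight      = just (clear y-phase)
turn (sink d)        = just (sink (opposite d))
turn (seek φ)        = just (sink leftward)
turn (advance φ)     = just (clear φ)
turn (clear y-phase) = just (advance x-phase)
turn (clear x-phase) = nothing
turn (odd φ)         = just (seek φ)
turn (even φ)        = just (seek φ)

direction-next : ∀ i A → direction (next i A) ≡ direction i
direction-next start       A = refl
direction-next checkLeft   A with fresh A
... | true  = refl
... | false = refl
direction-next checkRight  A with live A
... | true  = refl
... | false = refl
direction-next (sink d)    A = refl
direction-next (seek φ)    A with token φ A
... | true  = refl
... | false = refl
direction-next (advance φ) A = refl
direction-next (clear φ)   A with target φ A
... | true  = refl
... | false = refl
direction-next (odd φ)     A with target φ A
... | true  = refl
... | false = refl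
direction-next (even φ)    A with target φ A
... | true  = refl
... | false = refl

-- The letters written are pushed on the accumulator, so a sweep reverses the word.
sweep : Internal → List Letter → List Letter → Internal × List Letter
sweep i acc []      = i , acc
sweep i acc (A ∷ w) = sweep (next i A) (write i A ∷ acc) w

endState : Internal → List Letter → List Letter → Internal
endState i acc w = proj₁ (sweep i acc w)

written : Internal → List Letter → List Letter → List Letter
written i acc w = proj₂ (sweep i acc w)

-- An observation that no write changes sees only the reversal caused by the sweep. `S` is a set of
-- states that the sweep does not leave.
map-written : {B : Set} (f : Letter → B) (S : Internal → Set) →
              (∀ {i} A → S i → S (next i A)) → (∀ {i} A → S i → f (write i A) ≡ f A) →
              ∀ {i} acc w → S i → map f (written i acc w) ≡ map f (w ʳ++ acc)
map-written f S closed inv acc []      s = refl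
map-written f S closed inv {i} acc (A ∷ w) s = begin
  map f (written (next i A) (write i A ∷ acc) w)
    ≡⟨ map-written f S closed inv (write i A ∷ acc) w (closed A s) ⟩
  map f (w ʳ++ write i A ∷ acc)                  ≡⟨ map-ʳ++ f w ⟩
  map f w ʳ++ f (write i A) ∷ map f acc          ≡⟨ cong (λ B → map f w ʳ++ B ∷ map f acc) (inv A s) ⟩
  map f w ʳ++ f A ∷ map f acc                    ≡⟨ map-ʳ++ f w ⟨
  map f (w ʳ++ A ∷ acc)                          ∎
  where open ≡-Reasoning

-- A count depends only on the list of truth values, so `map-written` applies with `P` as the
-- observation.
count-written : (P : Letter → Bool) (S : Internal → Set) →
                (∀ {i} A → S i → S (next i A)) → (∀ {i} A → S i → P (write i A) ≡ P A) →
                ∀ {i} w → S i → count P (written i [] w) ≡ count P w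
count-written P S closed inv {i} w s = begin
  count P (written i [] w)                    ≡⟨ count-map (λ b → b) P (written i [] w) ⟨
  count (λ b → b) (map P (written i [] w))    ≡⟨ cong (count _) (map-written P S closed inv [] w s) ⟩
  count (λ b → b) (map P (w ʳ++ []))          ≡⟨ count-map (λ b → b) P (w ʳ++ []) ⟩
  count P (w ʳ++ [])                          ≡⟨ count-ʳ++ P w ⟩
  count P w + 0                               ≡⟨ +-identityʳ _ ⟩
  count P w                                   ∎
  where open ≡-Reasoning

-- Effect of one sweep on tokens and targets

module _ (φ : Phase) where
  data Seeking : Internal → Set where
    seek    : Seeking (seek φ)
    advance : Seeking (advance φ)

  data Clearing : Internal → Set where
    clear : Clearing (clear φ)
    odd   : Clearing (odd φ)
    even  : Clearing (even φ)

  seeking-next : ∀ {i} A → Seeking i → Seeking (next i A)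
  seeking-next A seek with token φ A
  ... | true  = advance
  ... | false = seek
  seeking-next A advance = advance

  clearing-next : ∀ {i} A → Clearing i → Clearing (next i A)
  clearing-next A clear with target φ A
  ... | true  = odd
  ... | false = clear
  clearing-next A odd with target φ A
  ... | true  = even
  ... | false = odd
  clearing-next A even with target φ A
  ... | true  = odd
  ... | false = even

  module _ {B : Set} (f : Letter → B) where
    seeking-write : (∀ A → token φ A ≡ true → f (toggle A) ≡ f A) →
                    ∀ {i} A → Seeking i → f (write i A) ≡ f A
    seeking-write inv A seek with token φ A in eq
    ... | true  = inv A eq
    ... | false = refl
    seeking-write inv A advance = refl

    clearing-write : (∀ A → target φ A ≡ true → f (toggle A) ≡ f A) →
                     ∀ {i} A → Clearing i → f (write i A) ≡ f A
    clearing-write inv A clear with target φ A in eq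
    ... | true  = inv A eq
    ... | false = refl
    clearing-write inv A odd = refl
    clearing-write inv A even with target φ A in eq
    ... | true  = inv A eq
    ... | false = refl

  -- Alternate targets survive. From `clear` and `even` the next one is spent, which leaves the
  -- floor; from `odd` it is kept, which leaves the ceiling.
  count-clear : ∀ acc w → count (target φ) (written (clear φ) acc w) ≡
                          ⌊ count (target φ) w /2⌋ + count (target φ) acc
  count-odd   : ∀ acc w → count (target φ) (written (odd φ) acc w) ≡
                          ⌈ count (target φ) w /2⌉ + count (target φ) acc
  count-even  : ∀ acc w → count (target φ) (written (even φ) acc w) ≡
                          ⌊ count (target φ) w /2⌋ + count (target φ) acc

  count-clear acc []      = refl
  count-clear acc (A ∷ w) with target φ A in eq
  ... | true  rewrite count-odd (toggle A ∷ acc) w | proj₁ (target-toggle φ A eq) = refl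
  ... | false rewrite count-clear (A ∷ acc) w | eq = refl

  count-odd acc []      = refl
  count-odd acc (A ∷ w) with target φ A in eq
  ... | true  rewrite count-even (A ∷ acc) w | eq = +-suc _ _
  ... | false rewrite count-odd (A ∷ acc) w | eq = refl

  count-even acc []      = refl
  count-even acc (A ∷ w) with target φ A in eq
  ... | true  rewrite count-odd (toggle A ∷ acc) w | proj₁ (target-toggle φ A eq) = refl
  ... | false rewrite count-even (A ∷ acc) w | eq = refl

  turn-odd  : ∀ acc w → turn (endState (odd φ) acc w) ≡ just (seek φ)
  turn-even : ∀ acc w → turn (endState (even φ) acc w) ≡ just (seek φ)
  turn-odd acc []      = refl
  turn-odd acc (A ∷ w) with target φ A
  ... | true  = turn-even _ w
  ... | false = turn-odd _ w
  turn-even acc []      = refl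
  turn-even acc (A ∷ w) with target φ A
  ... | true  = turn-odd _ w
  ... | false = turn-even _ w

  turn-clear : ∀ acc w {m} → count (target φ) w ≡ suc m →
               turn (endState (clear φ) acc w) ≡ just (seek φ)
  turn-clear acc (A ∷ w) eq with target φ A
  ... | true  = turn-odd _ w
  ... | false = turn-clear _ w eq

  endState-clear : ∀ acc w → count (target φ) w ≡ 0 → endState (clear φ) acc w ≡ clear φ
  endState-clear acc []      eq = refl
  endState-clear acc (A ∷ w) eq with target φ A
  ... | false = endState-clear _ w eq

  sweep-advance : ∀ acc w → sweep (advance φ) acc w ≡ (advance φ , w ʳ++ acc)
  sweep-advance acc []      = refl
  sweep-advance acc (A ∷ w) = sweep-advance (A ∷ acc) w

  endState-seek-none : ∀ acc w → count (token φ) w ≡ 0 → endState (seek φ) acc w ≡ seek φ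
  endState-seek-none acc []      eq = refl
  endState-seek-none acc (A ∷ w) eq with token φ A
  ... | false = endState-seek-none _ w eq

  endState-seek : ∀ acc w {t} → count (token φ) w ≡ suc t → endState (seek φ) acc w ≡ advance φ
  endState-seek acc (A ∷ w) eq with token φ A
  ... | true  = cong proj₁ (sweep-advance (toggle A ∷ acc) w)
  ... | false = endState-seek _ w eq

  count-seek : ∀ acc w {t} → count (token φ) w ≡ suc t →
               count (token φ) (written (seek φ) acc w) ≡ t + count (token φ) acc
  count-seek acc (A ∷ w) eq with token φ A in isToken
  count-seek acc (A ∷ w) refl | true
    rewrite sweep-advance (toggle A ∷ acc) w
          | count-ʳ++ (token φ) w {toggle A ∷ acc}
          | proj₁ (token-toggle φ A isToken) = refl
  count-seek acc (A ∷ w) eq   | false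
    rewrite count-seek (A ∷ acc) w eq | isToken = refl

sweep-sink : ∀ d acc w → endState (sink d) acc w ≡ sink d
sweep-sink d acc []      = refl
sweep-sink d acc (A ∷ w) = sweep-sink d _ w

sweep-check : ∀ (P : Letter → Bool) {i d} →
  (∀ A → next i A ≡ (if P A then i else sink d)) → (∀ A → write i A ≡ A) → ∀ acc w →
  (All (λ A → P A ≡ true) w × sweep i acc w ≡ (i , w ʳ++ acc)) ⊎
  (¬ All (λ A → P A ≡ true) w × endState i acc w ≡ sink d)
sweep-check P next-i write-i acc []      = inj₁ ([] , refl)
sweep-check P {i} {d} next-i write-i acc (A ∷ w) rewrite next-i A | write-i A with P A in eq
... | false = inj₂ ((λ { (PA ∷ _) → case trans (sym eq) PA of λ () }) , sweep-sink d _ w)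
... | true with sweep-check P {i} {d} next-i write-i (A ∷ acc) w
...   | inj₁ (all , ends)  = inj₁ (eq ∷ all , ends)
...   | inj₂ (¬all , ends) = inj₂ ((λ { (_ ∷ all) → ¬all all }) , ends)

-- Coding of the states and rules

internalIndex : Internal → Fin 15
internalIndex start             = 0F
internalIndex checkLeft         = 1F
internalIndex checkRight        = 2F
internalIndex (sink leftward)   = 3F
internalIndex (sink rightward)  = 4F
internalIndex (seek y-phase)    = 5F
internalIndex (seek x-phase)    = 6F
internalIndex (advance y-phase) = 7F
internalIndex (advance x-phase) = 8F
internalIndex (clear y-phase)   = 9F
internalIndex (clear x-phase)   = suc 9F
internalIndex (odd y-phase)     = suc (suc 9F)
internalIndex (odd x-phase)     = suc (suc (suc 9F))
internalIndex (even y-phase)    = suc (suc (suc (suc 9F)))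
internalIndex (even x-phase)    = suc (suc (suc (suc (suc 9F))))

fromIndex : Fin 15 → Internal
fromIndex = Vec.lookup
  ( start ∷ checkLeft ∷ checkRight ∷ sink leftward ∷ sink rightward
  ∷ seek y-phase ∷ seek x-phase ∷ advance y-phase ∷ advance x-phase
  ∷ clear y-phase ∷ clear x-phase ∷ odd y-phase ∷ odd x-phase ∷ even y-phase ∷ even x-phase ∷ [])

fromIndex-internalIndex : ∀ i → fromIndex (internalIndex i) ≡ i
fromIndex-internalIndex start             = refl
fromIndex-internalIndex checkLeft         = refl
fromIndex-internalIndex checkRight        = refl
fromIndex-internalIndex (sink leftward)   = refl
fromIndex-internalIndex (sink rightward)  = refl
fromIndex-internalIndex (seek y-phase)    = refl
fromIndex-internalIndex (seek x-phase)    = refl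
fromIndex-internalIndex (advance y-phase) = refl
fromIndex-internalIndex (advance x-phase) = refl
fromIndex-internalIndex (clear y-phase)   = refl
fromIndex-internalIndex (clear x-phase)   = refl
fromIndex-internalIndex (odd y-phase)     = refl
fromIndex-internalIndex (odd x-phase)     = refl
fromIndex-internalIndex (even y-phase)    = refl
fromIndex-internalIndex (even x-phase)    = refl

State : Set
State = Fin 18

pattern unmarked = 0F
pattern counting = 1F
pattern accepted = 2F
pattern indexed k = suc (suc (suc k))

internal : Internal → State
internal i = indexed (internalIndex i)

afterTurn : Internal → State
afterTurn i = maybe′ internal accepted (turn i)

Instruction : Sym 8 → Set
Instruction X = Σ State λ _ → ∃[ W ] ∃[ d ] ShiftOK X W d

instruction : Internal → ∀ X → Instruction X
instruction i lmark    = afterTurn i , lmark , rightward , atLeft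
instruction i rmark    = afterTurn i , rmark , leftward , atRight
instruction i (tape A) = internal (next i A) , tape (write i A) , direction i , inner _ _ _

-- Indexed by `Fin 15` rather than `Internal`, so that every internal state number visibly has a
-- rule for every symbol.
shiftRule : Fin 15 → Sym 8 → Rule 3 8 18
shiftRule k X =
  let q , W , d , ok = instruction (fromIndex k) X in shift (indexed k) X q W d ok

symbols : List (Sym 8)
symbols = lmark ∷ rmark ∷ map tape (allFin 8)

∈-symbols : ∀ X → X ∈ symbols
∈-symbols lmark    = here refl
∈-symbols rmark    = there (here refl)
∈-symbols (tape A) = there (there (∈-map⁺ tape (∈-allFin A)))

pattern mark   = 0F
pattern tally  = 1F
pattern launch = 2F

-- Each insertion leaves the head on the new Z, so the Zs inserted along a path form a block
-- beginning at the head. The launch adds one more, since a labelled rule must insert a letter.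
rules : List (Rule 3 8 18)
rules = insert unmarked rmark mark counting Z atRight
      ∷ insert counting (tape Z) tally counting Z (inner Z)
      ∷ insert counting (tape Z) launch (internal start) Z (inner Z)
      ∷ cartesianProductWith shiftRule (allFin 15) symbols

data Insertion : State → Sym 8 → Fin 3 → State → Letter → Set where
  marking   : Insertion unmarked rmark    mark   counting         Z
  tallying  : Insertion counting (tape Z) tally  counting         Z
  launching : Insertion counting (tape Z) launch (internal start) Z

insert∈rules : ∀ {p X a q A ok} → insert p X a q A ok ∈ rules → Insertion p X a q A
insert∈rules (here refl)                 = marking
insert∈rules (there (here refl))         = tallying
insert∈rules (there (there (here refl))) = launching
insert∈rules (there (there (there m)))
  with () ← proj₂ (proj₂ (proj₂ (proj₂ (∈-cartesianProductWith⁻ shiftRule (allFin 15) symbols m))))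

delete∉rules : ∀ {p A q} → ¬ delete p A q ∈ rules
delete∉rules (there (there (there m)))
  with () ← proj₂ (proj₂ (proj₂ (proj₂ (∈-cartesianProductWith⁻ shiftRule (allFin 15) symbols m))))

shift∈rules⁻ : ∀ {p X q W d ok} → shift p X q W d ok ∈ rules →
               ∃[ k ] p ≡ indexed k × (q , W , d , ok) ≡ instruction (fromIndex k) X
shift∈rules⁻ (there (there (there m)))
  with k , X , _ , _ , refl ← ∈-cartesianProductWith⁻ shiftRule (allFin 15) symbols m = k , refl , refl

shift∈rules⁺ : ∀ k X → shiftRule k X ∈ rules
shift∈rules⁺ k X = there (there (there (∈-cartesianProductWith⁺ shiftRule (∈-allFin k) (∈-symbols X))))

internalRule : ∀ i X {q W d ok} → instruction i X ≡ (q , W , d , ok) →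
               shift (internal i) X q W d ok ∈ rules
internalRule i X refl =
  subst (λ j → let q , W , d , ok = instruction j X in shift (internal i) X q W d ok ∈ rules)
        (fromIndex-internalIndex i) (shift∈rules⁺ (internalIndex i) X)

machine : LLBM 3
machine = record
  { g     = 8
  ; input = mk↣ {to = _↑ˡ 5} (↑ˡ-injective 5 _ _)
  ; n     = 18
  ; q₀    = unmarked
  ; F     = ∅
  ; δ     = rules
  }

external : Subset 18
external = inside ∷ inside ∷ inside ∷ ∅

indexed-∉ : ∀ k → indexed k ∉ˢ external
indexed-∉ k p = ∉⊥ (drop-there (drop-there (drop-there p)))

normalized : NormalizedLLBM 3
normalized = record
  { llbm            = machine
  ; QΣ              = external
  ; final-external  = λ p∈∅ → contradiction p∈∅ ∉⊥
  ; letter-external = letter-external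
  ; ε-internal      = ε-internal
  ; internal-total  = internal-total
  }
  where
  letter-external : ∀ {r a} → r ∈ rules → label r ≡ just a → lhsState r ∈ˢ external
  letter-external {insert _ _ _ _ _ _} m refl with insert∈rules m
  ... | marking   = here
  ... | tallying  = there here
  ... | launching = there here

  ε-internal : ∀ {r} → r ∈ rules → label r ≡ nothing → lhsState r ∉ˢ external
  ε-internal {shift _ _ _ _ _ _} m refl with k , refl , _ ← shift∈rules⁻ m = indexed-∉ k
  ε-internal {delete _ _ _}      m refl = contradiction m delete∉rules

  internal-total : ∀ {p} → p ∉ˢ external → ∀ X →
                   ∃[ q ] ∃[ W ] ∃[ d ] ∃[ ok ] shift p X q W d ok ∈ rules
  internal-total {unmarked}  p∉ X = contradiction here p∉
  internal-total {counting}  p∉ X = contradiction (there here) p∉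
  internal-total {accepted}  p∉ X = contradiction (there (there here)) p∉
  internal-total {indexed k} p∉ X = _ , _ , _ , _ , shift∈rules⁺ k X

-- Silent steps: determinism, sinks and sweeps

open NormalizedLLBM normalized using (Rewrites; shift+; shift-; delete; insert; Transition; External)

G : Graph 3
G = transitionGraph normalized

_⟶_ _⟶*_ : Config 8 18 → Config 8 18 → Set
_⟶_  = Transition nothing
_⟶*_ = Star _⟶_

-- All silent rules are shifts given by `instruction`, so the state and the scanned symbol fix the
-- rule and its direction; the mixed cases contradict this.
⟶-deterministic : ∀ {c d d′} → c ⟶ d → c ⟶ d′ → d ≡ d′
⟶-deterministic (_ , _ , delete m) _ = contradiction m delete∉rules
⟶-deterministic _ (_ , _ , delete m) = contradiction m delete∉rules
⟶-deterministic (_ , _ , shift+ m) (_ , _ , shift+ m′)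
  with k , refl , eq ← shift∈rules⁻ m | _ , refl , eq′ ← shift∈rules⁻ m′
  with refl ← trans eq (sym eq′) = refl
⟶-deterministic (_ , _ , shift- m) (_ , _ , shift- m′)
  with k , refl , eq ← shift∈rules⁻ m | _ , refl , eq′ ← shift∈rules⁻ m′
  with refl ← trans eq (sym eq′) = refl
⟶-deterministic (_ , _ , shift+ m) (_ , _ , shift- m′)
  with k , refl , eq ← shift∈rules⁻ m | _ , refl , eq′ ← shift∈rules⁻ m′
  with () ← trans eq (sym eq′)
⟶-deterministic (_ , _ , shift- m) (_ , _ , shift+ m′)
  with k , refl , eq ← shift∈rules⁻ m | _ , refl , eq′ ← shift∈rules⁻ m′
  with () ← trans eq (sym eq′)

external-terminal : ∀ {c d} → Config.state c ∈ˢ external → ¬ c ⟶ d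
external-terminal p∈ (_ , _ , shift+ m) with k , refl , _ ← shift∈rules⁻ m = indexed-∉ k p∈
external-terminal p∈ (_ , _ , shift- m) with k , refl , _ ← shift∈rules⁻ m = indexed-∉ k p∈
external-terminal p∈ (_ , _ , delete m) = delete∉rules m

-- Two runs from one configuration are comparable by determinism, and no silent step leaves an
-- external state. One explicitly built run thereby controls every run of an edge.
⟶*-continue : ∀ {c d e} → c ⟶* d → c ⟶* e → Config.state e ∈ˢ external → d ⟶* e
⟶*-continue ε σ e∈ = σ
⟶*-continue (s ◅ ρ) ε e∈ = contradiction s (external-terminal e∈)
⟶*-continue (s ◅ ρ) (t ◅ σ) e∈ with refl ← ⟶-deterministic s t = ⟶*-continue ρ σ e∈

⟶*-external : ∀ {c d} → Config.state c ∈ˢ external → c ⟶* d → c ≡ d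
⟶*-external c∈ ε       = refl
⟶*-external c∈ (s ◅ _) = contradiction s (external-terminal c∈)

Sunk : Config 8 18 → Set
Sunk c = ∃[ d ] Config.state c ≡ internal (sink d)

sunk-instruction : ∀ d X {q W d′ ok} →
  (q , W , d′ , ok) ≡ instruction (fromIndex (internalIndex (sink d))) X → ∃[ d″ ] q ≡ internal (sink d″)
sunk-instruction d X eq rewrite fromIndex-internalIndex (sink d) with X
sunk-instruction d _ refl | lmark  = opposite d , refl
sunk-instruction d _ refl | rmark  = opposite d , refl
sunk-instruction d _ refl | tape _ = d , refl

sunk-⟶ : ∀ {c d} → Sunk c → c ⟶ d → Sunk d
sunk-⟶ (d , refl) (_ , _ , shift+ m) with k , refl , eq ← shift∈rules⁻ m = sunk-instruction d _ eq
sunk-⟶ (d , refl) (_ , _ , shift- m) with k , refl , eq ← shift∈rules⁻ m = sunk-instruction d _ eq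
sunk-⟶ _          (_ , _ , delete m) = contradiction m delete∉rules

sunk-⟶* : ∀ {c d} → Sunk c → c ⟶* d → ¬ Config.state d ∈ˢ external
sunk-⟶* (_ , refl) ε = indexed-∉ _
sunk-⟶* sunk (s ◅ ρ) = sunk-⟶* (sunk-⟶ sunk s) ρ

-- l is stored from the head outwards.  The head reads the first letter of r in
-- headRight l q r and the first letter of l in headLeft l q r, or the end-marker
-- if that list is empty.
headRight : List Letter → State → List Letter → Config 8 18
headRight l q r = ⟨ map tape l ++ [ lmark ] , q , map tape r ++ [ rmark ] ⟩

headLeft : List Letter → State → List Letter → Config 8 18
headLeft []      q r = ⟨ [] , q , lmark ∷ map tape r ++ [ rmark ] ⟩
headLeft (A ∷ l) q r = headRight l q (A ∷ r)

isConfig-headRight : ∀ l q r → IsConfig (headRight l q r)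
isConfig-headRight l q r = nonempty r , l ʳ++ r , (begin
  (map tape l ++ [ lmark ]) ʳ++ map tape r ++ [ rmark ] ≡⟨ ++-ʳ++ (map tape l) ⟩
  lmark ∷ (map tape l ʳ++ map tape r ++ [ rmark ])      ≡⟨ cong (lmark ∷_) (unmap l r) ⟩
  lmark ∷ map tape (l ʳ++ r) ++ [ rmark ]               ∎)
  where
  open ≡-Reasoning
  nonempty : ∀ r → ¬ map tape r ++ [ rmark ] ≡ []
  nonempty []      ()
  nonempty (_ ∷ _) ()

  unmap : ∀ l r → map tape l ʳ++ map tape r ++ [ rmark ] ≡ map tape (l ʳ++ r) ++ [ rmark ]
  unmap []      r = refl
  unmap (A ∷ l) r = unmap l (A ∷ r)

isConfig-headLeft : ∀ l q r → IsConfig (headLeft l q r)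
isConfig-headLeft []      q r = (λ ()) , r , refl
isConfig-headLeft (A ∷ l) q r = isConfig-headRight l q (A ∷ r)

step-right : ∀ l i A r → direction i ≡ rightward →
             headRight l (internal i) (A ∷ r) ⟶ headRight (write i A ∷ l) (internal (next i A)) r
step-right l i A r d≡ =
  isConfig-headRight l (internal i) (A ∷ r) , isConfig-headRight (write i A ∷ l) (internal (next i A)) r ,
  shift+ (internalRule i (tape A)
    (cong (λ d → internal (next i A) , tape (write i A) , d , inner A (write i A) d) d≡))

step-left : ∀ l i A r → direction i ≡ leftward →
            headLeft (A ∷ l) (internal i) r ⟶ headLeft l (internal (next i A)) (write i A ∷ r)
step-left l i A r d≡ =
  isConfig-headLeft (A ∷ l) (internal i) r , isConfig-headLeft l (internal (next i A)) (write i A ∷ r) ,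
  rewrites l
  where
  rule = internalRule i (tape A)
    (cong (λ d → internal (next i A) , tape (write i A) , d , inner A (write i A) d) d≡)
  -- The symbol crossed is the left end-marker or a letter, and `headLeft` reduces only once it is
  -- known which.
  rewrites : ∀ l → Rewrites nothing (headLeft (A ∷ l) (internal i) r)
                                    (headLeft l (internal (next i A)) (write i A ∷ r))
  rewrites []      = shift- rule
  rewrites (B ∷ l) = shift- rule

turn-right : ∀ l i → headRight l (internal i) [] ⟶ headLeft l (afterTurn i) []
turn-right l i = isConfig-headRight l (internal i) [] , isConfig-headLeft l (afterTurn i) [] , rewrites l
  where
  rewrites : ∀ l → Rewrites nothing (headRight l (internal i) []) (headLeft l (afterTurn i) [])
  rewrites []      = shift- (internalRule i rmark refl)
  rewrites (B ∷ l) = shift- (internalRule i rmark refl)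

turn-left : ∀ i r → headLeft [] (internal i) r ⟶ headRight [] (afterTurn i) r
turn-left i r =
  isConfig-headLeft [] (internal i) r , isConfig-headRight [] (afterTurn i) r ,
  shift+ (internalRule i lmark refl)

sweep-right : ∀ i l r → direction i ≡ rightward →
              headRight l (internal i) r ⟶* headRight (written i l r) (internal (endState i l r)) []
sweep-right i l []      d≡ = ε
sweep-right i l (A ∷ r) d≡ =
  step-right l i A r d≡ ◅ sweep-right (next i A) _ r (trans (direction-next i A) d≡)

sweep-left : ∀ i l r → direction i ≡ leftward →
             headLeft l (internal i) r ⟶* headLeft [] (internal (endState i r l)) (written i r l)
sweep-left i []      r d≡ = ε
sweep-left i (A ∷ l) r d≡ =
  step-left l i A r d≡ ◅ sweep-left (next i A) l _ (trans (direction-next i A) d≡)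

-- Runs of the machine

half-<⁻ : ∀ m k → ⌊ m /2⌋ < k → m < 2 * k
half-<⁻ zero          (suc k) _       = s≤s z≤n
half-<⁻ (suc zero)    (suc k) _       rewrite +-suc k (k + 0) = s≤s (s≤s z≤n)
half-<⁻ (suc (suc m)) (suc k) (s≤s h) rewrite +-suc k (k + 0) = s≤s (s≤s (half-<⁻ m k h))

half-<⁺ : ∀ m k → m < 2 * k → ⌊ m /2⌋ < k
half-<⁺ zero          (suc k) _ = s≤s z≤n
half-<⁺ (suc zero)    (suc k) _ = s≤s z≤n
half-<⁺ (suc (suc m)) (suc k) h rewrite +-suc k (k + 0) with s≤s (s≤s h′) ← h = s≤s (half-<⁺ m k h′)

map-reverse-cong : {A B : Set} (f : A → B) (v w : List A) →
                   map f v ≡ map f w → map f (reverse v) ≡ map f (reverse w)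
map-reverse-cong f v w eq = begin
  map f (reverse v) ≡⟨ reverse-map f v ⟩
  reverse (map f v) ≡⟨ cong reverse eq ⟩
  reverse (map f w) ≡⟨ reverse-map f w ⟨
  map f (reverse w) ∎
  where open ≡-Reasoning

run-left : ∀ i l r {j r′} → direction i ≡ leftward → sweep i r l ≡ (j , r′) →
           headLeft l (internal i) r ⟶* headLeft [] (internal j) r′
run-left i l r d≡ refl = sweep-left i l r d≡

run-right : ∀ i l r {j l′} → direction i ≡ rightward → sweep i l r ≡ (j , l′) →
            headRight l (internal i) r ⟶* headRight l′ (internal j) []
run-right i l r d≡ refl = sweep-right i l r d≡

bounce-left : ∀ i {j} r → turn i ≡ just j → headLeft [] (internal i) r ⟶* headRight [] (internal j) r
bounce-left i r eq =
  subst (λ t → headLeft [] (internal i) r ⟶ headRight [] (maybe′ internal accepted t) r) eq (turn-left i r) ◅ ε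

bounce-right : ∀ i {j} l → turn i ≡ just j → headRight l (internal i) [] ⟶* headLeft l (internal j) []
bounce-right i l eq =
  subst (λ t → headRight l (internal i) [] ⟶ headLeft l (maybe′ internal accepted t) []) eq (turn-right l i) ◅ ε

Sinks : Config 8 18 → Set
Sinks c = ∃[ d ] c ⟶* d × Sunk d

sunk-headLeft : ∀ l d r → Sunk (headLeft l (internal (sink d)) r)
sunk-headLeft []      d r = d , refl
sunk-headLeft (_ ∷ _) d r = d , refl

module _ (φ : Phase) {B : Set} (f : Letter → B)
         (f-token  : ∀ A → token φ A ≡ true → f (toggle A) ≡ f A)
         (f-target : ∀ A → target φ A ≡ true → f (toggle A) ≡ f A) where

  PhaseOutcome : ℕ → List Letter → Set
  PhaseOutcome t l =
    (count (target φ) l < 2 ^ t ×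
     ∃[ r ] headLeft l (internal (clear φ)) [] ⟶* headLeft [] (internal (clear φ)) r ×
            count (target φ) r ≡ 0 × map f r ≡ map f (reverse l)) ⊎
    (¬ count (target φ) l < 2 ^ t × Sinks (headLeft l (internal (clear φ)) []))

  -- A round halves the targets and then spends a token. The `t` tokens pay for `t` rounds, and `t`
  -- halvings reach zero exactly from numbers below `2 ^ t`. The observation `f` is carried along so
  -- that the word can be recovered.
  phaseRun : ∀ t l → count (token φ) l ≡ t → PhaseOutcome t l
  phaseRun t l tokens = cases t tokens _ refl
    where
    r = written (clear φ) [] l

    f-r : map f r ≡ map f (reverse l)
    f-r = map-written f (Clearing φ) (clearing-next φ) (clearing-write φ f f-target) [] l clear

    tokens-r : count (token φ) r ≡ count (token φ) l
    tokens-r = count-written (token φ) (Clearing φ) (clearing-next φ)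
      (clearing-write φ (token φ) (λ A eq → proj₂ (target-toggle φ A eq))) l clear

    targets-r : count (target φ) r ≡ ⌊ count (target φ) l /2⌋
    targets-r = trans (count-clear φ [] l) (+-identityʳ _)

    l′ = written (seek φ) [] r

    f-l′ : map f l′ ≡ map f (reverse r)
    f-l′ = map-written f (Seeking φ) (seeking-next φ) (seeking-write φ f f-token) [] r seek

    targets-l′ : count (target φ) l′ ≡ count (target φ) r
    targets-l′ = count-written (target φ) (Seeking φ) (seeking-next φ)
      (seeking-write φ (target φ) (λ A eq → proj₂ (token-toggle φ A eq))) r seek

    halved : ∀ {m} → count (target φ) l ≡ suc m →
             headLeft l (internal (clear φ)) [] ⟶* headRight [] (internal (seek φ)) r
    halved eq = run-left (clear φ) l [] refl refl ◅◅ bounce-left _ r (turn-clear φ [] l eq)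

    cases : ∀ t → count (token φ) l ≡ t → ∀ m → count (target φ) l ≡ m → PhaseOutcome t l
    cases t _ zero targets = inj₁
      ( subst (_< 2 ^ t) (sym targets) (m^n>0 2 t)
      , r , run-left (clear φ) l [] refl (cong (_, r) (endState-clear φ [] l targets))
      , trans targets-r (cong ⌊_/2⌋ targets) , f-r )
    -- Even a halving down to zero must be paid for: `2 ^ 0` is 1, so without tokens a single target
    -- is too many.
    cases zero tokens (suc m) targets = inj₂
      ( (λ lt → case subst (_< 1) targets lt of λ { (s≤s ()) })
      , _ , halved targets
            ◅◅ run-right (seek φ) [] r refl (cong (_, l′) (endState-seek-none φ [] r (trans tokens-r tokens)))
            ◅◅ bounce-right (seek φ) l′ refl
      , sunk-headLeft l′ leftward [] )
    cases (suc t) tokens (suc m) targets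
      -- Two sweeps later the head is back at the right end, with one token fewer and half the
      -- targets.
      with phaseRun t l′ (trans (count-seek φ [] r (trans tokens-r tokens)) (+-identityʳ t))
    ... | inj₁ (lt , r″ , run , cleared , f-r″) = inj₁
      ( half-<⁻ _ (2 ^ t) (subst (_< 2 ^ t) (trans targets-l′ targets-r) lt)
      , r″ , reach ◅◅ run , cleared , (begin
          map f r″                    ≡⟨ f-r″ ⟩
          map f (reverse l′)          ≡⟨ map-reverse-cong f l′ (reverse r) f-l′ ⟩
          map f (reverse (reverse r)) ≡⟨ cong (map f) (reverse-involutive r) ⟩
          map f r                     ≡⟨ f-r ⟩
          map f (reverse l)           ∎) )
      where
      open ≡-Reasoning
      reach = halved targets
        ◅◅ run-right (seek φ) [] r refl (cong (_, l′) (endState-seek φ [] r (trans tokens-r tokens)))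
        ◅◅ bounce-right (advance φ) l′ refl
    ... | inj₂ (¬lt , c , run , sunk) = inj₂
      ( (λ lt → ¬lt (subst (_< 2 ^ t) (sym (trans targets-l′ targets-r)) (half-<⁺ _ (2 ^ t) lt)))
      , c , reach ◅◅ run , sunk )
      where
      reach = halved targets
        ◅◅ run-right (seek φ) [] r refl (cong (_, l′) (endState-seek φ [] r (trans tokens-r tokens)))
        ◅◅ bounce-right (advance φ) l′ refl

-- Once no Y is left, this makes the tokens of the second phase as numerous as the Ys of the
-- original word.
count-yKind : ∀ w → count (target y-phase) w + count (token x-phase) w ≡
                    count (target y-phase) (map revive w)
count-yKind []        = refl
count-yKind (X₀ ∷ w)  = count-yKind w
count-yKind (X₁ ∷ w)  = count-yKind w
count-yKind (Y ∷ w)   = cong suc (count-yKind w)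
count-yKind (Z ∷ w)   = count-yKind w
count-yKind (X₀′ ∷ w) = count-yKind w
count-yKind (X₁′ ∷ w) = count-yKind w
count-yKind (Y′ ∷ w)  = trans (+-suc _ _) (cong suc (count-yKind w))
count-yKind (Z′ ∷ w)  = count-yKind w

revive-live : ∀ A → live A ≡ true → revive A ≡ A
revive-live X₀ _ = refl
revive-live X₁ _ = refl
revive-live Y  _ = refl
revive-live Z  _ = refl
revive-live X₀′ ()
revive-live X₁′ ()
revive-live Y′ ()
revive-live Z′ ()

Live Fresh : List Letter → Set
Live  = All (λ A → live A ≡ true)
Fresh = All (λ A → fresh A ≡ true)

map-revive-live : ∀ {w} → Live w → map revive w ≡ w
map-revive-live []                = refl
map-revive-live (A-live ∷ w-live) = cong₂ _∷_ (revive-live _ A-live) (map-revive-live w-live)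

zs ys xs : List Letter → ℕ
zs = count (token y-phase)
ys = count (target y-phase)
xs = count (target x-phase)

-- Decides `P` along with the fate of the run: acceptance yields edges, sinking excludes them, and
-- the revived tape determines the source of an edge.
Outcome : Config 8 18 → List Letter → Set → Set
Outcome c w P =
  (P × ∃[ r ] c ⟶* headRight [] accepted r × map revive r ≡ w) ⊎ (¬ P × Sinks c)

outcome-map : ∀ {c d w P Q} → c ⟶* d → (P → Q) → (Q → P) → Outcome d w P → Outcome c w Q
outcome-map ρ to from (inj₁ (p , r , run , eq))     = inj₁ (to p , r , ρ ◅◅ run , eq)
outcome-map ρ to from (inj₂ (¬p , d , run , sunk)) = inj₂ ((λ q → ¬p (from q)) , d , ρ ◅◅ run , sunk)

count-reverse : {A : Set} (P : A → Bool) (w : List A) → count P (reverse w) ≡ count P w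
count-reverse P w = trans (count-ʳ++ P w) (+-identityʳ _)

xStart : ∀ r → headRight [] (internal (advance x-phase)) r ⟶* headLeft (reverse r) (internal (clear x-phase)) []
xStart r = run-right (advance x-phase) [] r refl (sweep-advance x-phase [] r)
           ◅◅ bounce-right (advance x-phase) (reverse r) refl

xRun : ∀ r → Outcome (headRight [] (internal (advance x-phase)) r) (map revive r)
                     (xs r < 2 ^ count (token x-phase) r)
xRun r with phaseRun x-phase revive (λ A _ → revive-toggle A) (λ A _ → revive-toggle A)
              (count (token x-phase) r) (reverse r) (count-reverse _ r)
... | inj₁ (lt , r′ , run , _ , eq) = inj₁
  ( subst (_< 2 ^ count (token x-phase) r) (count-reverse _ r) lt
  , r′ , xStart r ◅◅ run ◅◅ (turn-left (clear x-phase) r′ ◅ ε)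
  , trans eq (cong (map revive) (reverse-involutive r)) )
... | inj₂ (¬lt , c , run , sunk) = inj₂
  ( (λ lt → ¬lt (subst (_< 2 ^ count (token x-phase) r) (sym (count-reverse _ r)) lt))
  , c , xStart r ◅◅ run , sunk )

-- What the y-phase leaves unchanged in every letter.
yObservable : Letter → Letter × Bool
yObservable A = revive A , target x-phase A

yObservable-token : ∀ A → token y-phase A ≡ true → yObservable (toggle A) ≡ yObservable A
yObservable-token Z refl = refl

yObservable-target : ∀ A → target y-phase A ≡ true → yObservable (toggle A) ≡ yObservable A
yObservable-target Y refl = refl

-- A successful first phase has spent all Ys and no Xs, so the second phase compares the Xs of `w`
-- with the Ys of `w`.
yRun : ∀ w → Live w → Outcome (headLeft (reverse w) (internal (clear y-phase)) []) w
                              (ys w < 2 ^ zs w × xs w < 2 ^ ys w)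
yRun w w-live with phaseRun y-phase yObservable yObservable-token yObservable-target
                     (zs w) (reverse w) (count-reverse _ w)
... | inj₂ (¬lt , sinks) = inj₂
  ((λ (lt , _) → ¬lt (subst (_< 2 ^ zs w) (sym (count-reverse _ w)) lt)) , sinks)
... | inj₁ (lt , r , run , cleared , same) = outcome-map (run ◅◅ bounce-left (clear y-phase) r refl)
  (λ small → subst (_< 2 ^ zs w) (count-reverse _ w) lt , subst (λ (x , y) → x < 2 ^ y) counts small)
  (λ (_ , small) → subst (λ (x , y) → x < 2 ^ y) (sym counts) small)
  (subst (λ v → Outcome (headRight [] (internal (advance x-phase)) r) v (xs r < 2 ^ count (token x-phase) r))
         revived (xRun r))
  where
  open ≡-Reasoning
  same′ : map yObservable r ≡ map yObservable w
  same′ = trans same (cong (map yObservable) (reverse-involutive w))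

  revived : map revive r ≡ w
  revived = begin
    map revive r                    ≡⟨ map-∘ r ⟩
    map proj₁ (map yObservable r)   ≡⟨ cong (map proj₁) same′ ⟩
    map proj₁ (map yObservable w)   ≡⟨ map-∘ w ⟨
    map revive w                    ≡⟨ map-revive-live w-live ⟩
    w                               ∎

  counts : (xs r , count (token x-phase) r) ≡ (xs w , ys w)
  counts = cong₂ _,_
    (begin
      xs r                            ≡⟨ count-map proj₂ yObservable r ⟨
      count proj₂ (map yObservable r) ≡⟨ cong (count proj₂) same′ ⟩
      count proj₂ (map yObservable w) ≡⟨ count-map proj₂ yObservable w ⟩
      xs w                            ∎)
    (begin
      count (token x-phase) r        ≡⟨ cong (_+ count (token x-phase) r) cleared ⟨
      ys r + count (token x-phase) r ≡⟨ count-yKind r ⟩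
      ys (map revive r)              ≡⟨ cong ys revived ⟩
      ys w                           ∎)

checkRightRun : ∀ w → Outcome (headRight [] (internal checkRight) w) w
                              (Live w × ys w < 2 ^ zs w × xs w < 2 ^ ys w)
checkRightRun w with sweep-check live {checkRight} {rightward} (λ _ → refl) (λ _ → refl) [] w
... | inj₁ (w-live , ends) =
  outcome-map (run-right checkRight [] w refl ends ◅◅ bounce-right checkRight (reverse w) refl)
    (w-live ,_) proj₂ (yRun w w-live)
... | inj₂ (¬live , ends) = inj₂
  ( (λ (w-live , _) → ¬live w-live)
  , _ , run-right checkRight [] w refl (cong (_, l) ends) ◅◅ bounce-right (sink rightward) l refl
  , sunk-headLeft l leftward [] )
  where l = written checkRight [] w

Launchable : List Letter → List Letter → Set
Launchable l w = Fresh l × Live w × ys w < 2 ^ zs w × xs w < 2 ^ ys w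

-- The run begins just after the insertion: the first Z is the inserted one, the second was under
-- the head before.
launchRun : ∀ l r → let w = l ʳ++ Z ∷ Z ∷ r in
            Outcome (headRight l (internal start) (Z ∷ Z ∷ r)) w (Launchable l w)
launchRun l r with sweep-check fresh {checkLeft} {leftward} (λ _ → refl) (λ _ → refl) (Z ∷ Z ∷ r) l
... | inj₁ (l-fresh , ends) = outcome-map
  (step-left l start Z (Z ∷ r) refl ◅ run-left checkLeft l (Z ∷ Z ∷ r) refl ends
   ◅◅ bounce-left checkLeft (l ʳ++ Z ∷ Z ∷ r) refl)
  (l-fresh ,_) proj₂ (checkRightRun (l ʳ++ Z ∷ Z ∷ r))
... | inj₂ (¬fresh , ends) = inj₂
  ( (λ (l-fresh , _) → ¬fresh l-fresh)
  , _ , step-left l start Z (Z ∷ r) refl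
        ◅ run-left checkLeft l (Z ∷ Z ∷ r) refl (cong (_, written checkLeft (Z ∷ Z ∷ r) l) ends)
  , leftward , refl )

ʳ++⁺ : {A : Set} {P : A → Set} {l r : List A} → All P l → All P r → All P (l ʳ++ r)
ʳ++⁺ []       ps = ps
ʳ++⁺ (p ∷ qs) ps = ʳ++⁺ qs (p ∷ ps)

-- The transition graph

lookup-injective : {A : Set} {xs : List A} → Unique xs → ∀ i j → lookup xs i ≡ lookup xs j → i ≡ j
lookup-injective (x∉ ∷ uniq) zero    zero    _  = refl
lookup-injective (x∉ ∷ uniq) zero    (suc j) eq = contradiction eq (All.lookup x∉ (∈-lookup j))
lookup-injective (x∉ ∷ uniq) (suc i) zero    eq = contradiction (sym eq) (All.lookup x∉ (∈-lookup i))
lookup-injective (x∉ ∷ uniq) (suc i) (suc j) eq = cong suc (lookup-injective uniq i j eq)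

module _ {s} (K : Graph s) where
  open Graph K

  -- An edge at `x` is determined by its label and by whether `x` is its source or its target.
  boundedDegree : (∀ {x a y y′} → Edge x a y → Edge x a y′ → y ≡ y′) →
                  (∀ {x x′ a y} → Edge x a y → Edge x′ a y → x ≡ x′) → BoundedDegree K
  boundedDegree deterministic codeterministic = 2 * s , λ x es unique incident →
    injective⇒≤ {f = λ i → class (All.lookup incident (∈-lookup i))} λ {i} {j} eq →
      lookup-injective unique i j
        (class-injective (All.lookup incident (∈-lookup i)) (All.lookup incident (∈-lookup j)) eq)
    where
    class : ∀ {x e} → Incident x e → Fin (2 * s)
    class {e = _ , a , _} (_ , inj₁ _) = combine {2} 0F a
    class {e = _ , a , _} (_ , inj₂ _) = combine {2} 1F a

    class-injective : ∀ {x e e′} (i : Incident x e) (i′ : Incident x e′) → class i ≡ class i′ → e ≡ e′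
    class-injective {e = _ , a , _} {_ , a′ , _} (E , inj₁ refl) (E′ , inj₁ refl) eq
      with _ , refl ← combine-injective {2} 0F a 0F a′ eq
      with refl ← deterministic E E′ = refl
    class-injective {e = _ , a , _} {_ , a′ , _} (E , inj₂ refl) (E′ , inj₂ refl) eq
      with _ , refl ← combine-injective {2} 1F a 1F a′ eq
      with refl ← codeterministic E E′ = refl
    class-injective {e = _ , a , _} {_ , a′ , _} (E , inj₁ _) (E′ , inj₂ _) eq
      with () ← proj₁ (combine-injective {2} 0F a 1F a′ eq)
    class-injective {e = _ , a , _} {_ , a′ , _} (E , inj₂ _) (E′ , inj₁ _) eq
      with () ← proj₁ (combine-injective {2} 1F a 0F a′ eq)

tape-injective : ∀ {A B : Letter} → tape A ≡ tape B → A ≡ B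
tape-injective refl = refl

headRight-injective : ∀ {l q r l′ q′ r′} → headRight l q r ≡ headRight l′ q′ r′ → l ≡ l′ × r ≡ r′
headRight-injective {l} {q} {r} {l′} {q′} {r′} eq =
  map-injective tape-injective (++-cancelʳ [ lmark ] (map tape l) (map tape l′) (cong Config.leftʳ eq)) ,
  map-injective tape-injective (++-cancelʳ [ rmark ] (map tape r) (map tape r′) (cong Config.right eq))

tape-split : ∀ (a : List (Sym 8)) {v} w → ¬ v ≡ [] → a ++ v ≡ map tape w ++ [ rmark ] →
             ∃[ l ] ∃[ r ] a ≡ map tape l × v ≡ map tape r ++ [ rmark ]
tape-split []      w       v≢[] eq   = [] , w , refl , eq
tape-split (x ∷ []) []     v≢[] refl = contradiction refl v≢[]
tape-split (x ∷ a) (B ∷ w) v≢[] eq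
  with refl , eq′ ← ∷-injective eq
  with l , r , refl , refl ← tape-split a w v≢[] eq′ = B ∷ l , r , refl , refl

-- If `u` were empty, `v` would begin with the left end-marker. `IsConfig` appears unfolded because
-- it does not mention the state, which could not be inferred.
config-split : ∀ {u v} → ¬ v ≡ [] × ∃[ w ] u ʳ++ v ≡ lmark ∷ map tape w ++ [ rmark ] →
               (∀ v′ → ¬ v ≡ lmark ∷ v′) →
               ∃[ l ] ∃[ r ] u ≡ map tape l ++ [ lmark ] × v ≡ map tape r ++ [ rmark ]
config-split {u} {v} (v≢[] , w , eq) v≢lmark = view (reverse u) refl (trans (sym (ʳ++-defn u)) eq)
  where
  view : ∀ a → reverse u ≡ a → a ++ v ≡ lmark ∷ map tape w ++ [ rmark ] →
         ∃[ l ] ∃[ r ] u ≡ map tape l ++ [ lmark ] × v ≡ map tape r ++ [ rmark ]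
  view []      _  eq = contradiction eq (v≢lmark _)
  view (x ∷ a) u≡ eq with refl , eq′ ← ∷-injective eq
                     with l , r , refl , v≡ ← tape-split a w v≢[] eq′
    = reverse l , r , (begin
      u                                 ≡⟨ reverse-involutive u ⟨
      reverse (reverse u)               ≡⟨ cong reverse u≡ ⟩
      reverse (lmark ∷ map tape l)      ≡⟨ unfold-reverse lmark (map tape l) ⟩
      reverse (map tape l) ++ [ lmark ] ≡⟨ cong (_++ [ lmark ]) (reverse-map tape l) ⟨
      map tape (reverse l) ++ [ lmark ] ∎) , v≡
    where open ≡-Reasoning

config-rmark : ∀ {u v} → ¬ rmark ∷ v ≡ [] × ∃[ w ] u ʳ++ rmark ∷ v ≡ lmark ∷ map tape w ++ [ rmark ] →
               ∃[ l ] u ≡ map {B = Sym 8} tape l ++ [ lmark ] × v ≡ []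
config-rmark {u} ok with config-split {u} ok (λ _ ())
... | l , []    , u≡ , refl = l , u≡ , refl
... | l , _ ∷ _ , _  , ()

config-tape : ∀ {u A v} → ¬ tape A ∷ v ≡ [] × ∃[ w ] u ʳ++ tape A ∷ v ≡ lmark ∷ map tape w ++ [ rmark ] →
              ∃[ l ] ∃[ r ] u ≡ map {B = Sym 8} tape l ++ [ lmark ] × v ≡ map tape r ++ [ rmark ]
config-tape {u} ok with config-split {u} ok (λ _ ())
... | l , []    , _  , ()
... | l , _ ∷ r , u≡ , refl = l , r , u≡ , refl

-- The endpoints enter through equations because `headRight` is not a constructor; views of two
-- edges are then compared by `headRight-injective`.
data EdgeView (c : Config 8 18) : Fin 3 → Config 8 18 → Set where
  marking   : ∀ l {c′} → c ≡ headRight l unmarked [] →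
              c′ ≡ headRight l counting (Z ∷ []) → EdgeView c mark c′
  tallying  : ∀ l r {c′} → c ≡ headRight l counting (Z ∷ r) →
              c′ ≡ headRight l counting (Z ∷ Z ∷ r) → EdgeView c tally c′
  launching : ∀ l r r′ {c′} → c ≡ headRight l counting (Z ∷ r) → c′ ≡ headRight [] accepted r′ →
              Launchable l (l ʳ++ Z ∷ Z ∷ r) → map revive r′ ≡ l ʳ++ Z ∷ Z ∷ r →
              EdgeView c launch c′

edge-view : ∀ {c a c′} → Graph.Edge G c a c′ → EdgeView c a c′
edge-view (_ , (_ , c′∈) , _ , (c-ok , _ , insert {u = u} m) , ρ) with insert∈rules m
... | marking
  with l , refl , refl ← config-rmark {u} c-ok
  with refl ← ⟶*-external (there here) ρ = marking l refl refl
... | tallying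
  with l , r , refl , refl ← config-tape {u} c-ok
  with refl ← ⟶*-external (there here) ρ = tallying l r refl refl
... | launching
  with l , r , refl , refl ← config-tape {u} c-ok
  with launchRun l r
-- The run `ρ` of the edge continues the explicit run, which has already stopped in an external
-- state.
...   | inj₁ (good , r′ , run , revived)
  with refl ← ⟶*-external (there (there here)) (⟶*-continue run ρ c′∈) = launching l r r′ refl refl good revived
...   | inj₂ (_ , _ , run , sunk) = contradiction c′∈ (sunk-⟶* sunk (⟶*-continue run ρ c′∈))

mark-edge : ∀ l → Graph.Edge G (headRight l unmarked []) mark (headRight l counting (Z ∷ []))
mark-edge l =
  (from , here) , (to , there here) ,
  _ , (from , to , insert (here refl)) , ε
  where
  from = isConfig-headRight l unmarked []
  to   = isConfig-headRight l counting (Z ∷ [])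

tally-edge : ∀ l r → Graph.Edge G (headRight l counting (Z ∷ r)) tally (headRight l counting (Z ∷ Z ∷ r))
tally-edge l r =
  (from , there here) , (to , there here) ,
  _ , (from , to , insert (there (here refl))) , ε
  where
  from = isConfig-headRight l counting (Z ∷ r)
  to   = isConfig-headRight l counting (Z ∷ Z ∷ r)

launch-edge : ∀ l r → Launchable l (l ʳ++ Z ∷ Z ∷ r) →
              ∃[ r′ ] Graph.Edge G (headRight l counting (Z ∷ r)) launch (headRight [] accepted r′)
launch-edge l r good with launchRun l r
... | inj₂ (bad , _) = contradiction good bad
... | inj₁ (_ , r′ , run , _) = r′ ,
  (from , there here) , (isConfig-headRight [] accepted r′ , there (there here)) ,
  _ , (from , isConfig-headRight l (internal start) (Z ∷ Z ∷ r) ,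
       insert (there (there (here refl)))) , run
  where
  from = isConfig-headRight l counting (Z ∷ r)

insertion-functional : ∀ {p X a q q′ A A′} → Insertion p X a q A → Insertion p X a q′ A′ → q ≡ q′ × A ≡ A′
insertion-functional marking   marking   = refl , refl
insertion-functional tallying  tallying  = refl , refl
insertion-functional launching launching = refl , refl

G-deterministic : ∀ {c a c′ c″} → Graph.Edge G c a c′ → Graph.Edge G c a c″ → c′ ≡ c″
G-deterministic (_ , (_ , c′∈) , _ , (_ , _ , insert m) , ρ) (_ , (_ , c″∈) , _ , (_ , _ , insert m′) , σ)
  with refl , refl ← insertion-functional (insert∈rules m) (insert∈rules m′)
  = ⟶*-external c′∈ (⟶*-continue ρ σ c″∈)

-- Both splittings are at the leftmost Z of the word.
fresh-prefix : ∀ {l l′ r r′} → Fresh l → Fresh l′ → l ++ Z ∷ r ≡ l′ ++ Z ∷ r′ → l ≡ l′ × r ≡ r′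
fresh-prefix []       []       refl = refl , refl
fresh-prefix []       (() ∷ _) refl
fresh-prefix (() ∷ _) []       refl
fresh-prefix (_ ∷ p)  (_ ∷ p′) eq
  with refl , eq′ ← ∷-injective eq
  with refl , refl ← fresh-prefix p p′ eq′ = refl , refl

fresh-prefixʳ : ∀ {l l′ r r′} → Fresh l → Fresh l′ → l ʳ++ Z ∷ r ≡ l′ ʳ++ Z ∷ r′ → l ≡ l′ × r ≡ r′
fresh-prefixʳ {l} {l′} l-fresh l′-fresh eq
  with l≡l′ , r≡r′ ← fresh-prefix (ʳ++⁺ l-fresh []) (ʳ++⁺ l′-fresh [])
                       (trans (sym (ʳ++-defn l)) (trans eq (ʳ++-defn l′)))
  = reverse-injective l≡l′ , r≡r′

-- Insertions by `mark` and `tally` can be undone. For `launch`, the revived tape gives the word and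
-- its leftmost Z the position of the head.
G-codeterministic : ∀ {c d a c′} → Graph.Edge G c a c′ → Graph.Edge G d a c′ → c ≡ d
G-codeterministic e f with edge-view e | edge-view f
... | marking l refl refl | marking l′ refl eq
  with refl , _ ← headRight-injective {l} {_} {Z ∷ []} {l′} {_} {Z ∷ []} eq = refl
... | tallying l r refl refl | tallying l′ r′ refl eq
  with refl , refl ← headRight-injective {l} {_} {Z ∷ Z ∷ r} {l′} {_} {Z ∷ Z ∷ r′} eq = refl
... | launching l r s refl refl (l-fresh , _) revived | launching l′ r′ s′ refl eq (l′-fresh , _) revived′
  with _ , refl ← headRight-injective {[]} {_} {s} {[]} {_} {s′} eq
  with refl , refl ← fresh-prefixʳ l-fresh l′-fresh (trans (sym revived) revived′) = refl

G-boundedDegree : BoundedDegree G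
G-boundedDegree = boundedDegree G G-deterministic G-codeterministic

isomorphic-refl : ∀ {s} (K : Graph s) → Isomorphic K K
isomorphic-refl K = bijection (Graph.Support K) , λ _ _ _ → mk⇔ (λ e → e) (λ e → e)

-- Sources of paths labelled `traceWord n`

traceWord : ℕ → List (Fin 3)
traceWord n = mark ∷ replicate n tally ++ [ launch ]

trace-view : ∀ n {c} → Trace G c (traceWord n) →
             ∃[ l ] c ≡ headRight l unmarked [] × Launchable l (l ʳ++ Z ∷ Z ∷ replicate n Z)
trace-view n (_ , e , τ) with edge-view e
... | marking l refl refl = l , refl ,
  subst (λ k → Launchable l (l ʳ++ Z ∷ Z ∷ replicate k Z)) (+-identityʳ n) (go n 0 τ)
  where
  -- `k` is the number of `tally` edges already traversed; `mark` and `launch` contribute the two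
  -- further Zs.
  go : ∀ n k → Trace G (headRight l counting (Z ∷ replicate k Z)) (replicate n tally ++ [ launch ]) →
       Launchable l (l ʳ++ Z ∷ Z ∷ replicate (n + k) Z)
  go zero k (_ , e , _) with edge-view e
  ... | launching l′ r′ _ eq _ good _
    with refl , refl ← headRight-injective {l} {_} {Z ∷ replicate k Z} {l′} {_} {Z ∷ r′} eq = good
  go (suc n) k (_ , e , τ) with edge-view e
  ... | tallying l′ r′ eq refl
    with refl , refl ← headRight-injective {l} {_} {Z ∷ replicate k Z} {l′} {_} {Z ∷ r′} eq
    = subst (λ m → Launchable l (l ʳ++ Z ∷ Z ∷ replicate m Z)) (+-suc n k) (go n (suc k) τ)

trace-intro : ∀ n l → Launchable l (l ʳ++ Z ∷ Z ∷ replicate n Z) →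
              Trace G (headRight l unmarked []) (traceWord n)
trace-intro n l good = _ , mark-edge l ,
  go n 0 (subst (λ k → Launchable l (l ʳ++ Z ∷ Z ∷ replicate k Z)) (sym (+-identityʳ n)) good)
  where
  go : ∀ n k → Launchable l (l ʳ++ Z ∷ Z ∷ replicate (n + k) Z) →
       Trace G (headRight l counting (Z ∷ replicate k Z)) (replicate n tally ++ [ launch ])
  go zero    k good = _ , proj₂ (launch-edge l (replicate k Z) good) , _
  go (suc n) k good = _ , tally-edge l (replicate k Z) ,
    go n (suc k) (subst (λ m → Launchable l (l ʳ++ Z ∷ Z ∷ replicate m Z)) (sym (+-suc n k)) good)

m<2^m : ∀ m → m < 2 ^ m
m<2^m zero    = s≤s z≤n
m<2^m (suc m) = begin
  suc (suc m)   ≡⟨ +-comm 1 (suc m) ⟩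
  suc m + 1     ≤⟨ +-mono-≤ (m<2^m m) (m^n>0 2 m) ⟩
  2 ^ m + 2 ^ m ≡⟨ cong (2 ^ m +_) (+-identityʳ (2 ^ m)) ⟨
  2 ^ suc m     ∎
  where open ≤-Reasoning

count-replicate : {A : Set} (P : A → Bool) {x : A} → P x ≡ true → ∀ n → count P (replicate n x) ≡ n
count-replicate P Px zero    = refl
count-replicate P Px (suc n) rewrite Px = cong suc (count-replicate P Px n)

count-replicate-false : {A : Set} (P : A → Bool) {x : A} → P x ≡ false → ∀ n → count P (replicate n x) ≡ 0
count-replicate-false P ¬Px zero    = refl
count-replicate-false P ¬Px (suc n) rewrite ¬Px = count-replicate-false P ¬Px n

fresh-zs : ∀ {l} → Fresh l → zs l ≡ 0
fresh-zs []                = refl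
fresh-zs {X₀ ∷ _} (_ ∷ fr) = fresh-zs fr
fresh-zs {X₁ ∷ _} (_ ∷ fr) = fresh-zs fr
fresh-zs {Y ∷ _}  (_ ∷ fr) = fresh-zs fr
fresh-zs {Z ∷ _}   (() ∷ _)
fresh-zs {X₀′ ∷ _} (() ∷ _)
fresh-zs {X₁′ ∷ _} (() ∷ _)
fresh-zs {Y′ ∷ _}  (() ∷ _)
fresh-zs {Z′ ∷ _}  (() ∷ _)

fresh-length : ∀ {l} → Fresh l → length l ≡ ys l + xs l
fresh-length []                = refl
fresh-length {X₀ ∷ l} (_ ∷ fr) = trans (cong suc (fresh-length fr)) (sym (+-suc (ys l) (xs l)))
fresh-length {X₁ ∷ l} (_ ∷ fr) = trans (cong suc (fresh-length fr)) (sym (+-suc (ys l) (xs l)))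
fresh-length {Y ∷ _}  (_ ∷ fr) = cong suc (fresh-length fr)
fresh-length {Z ∷ _}   (() ∷ _)
fresh-length {X₀′ ∷ _} (() ∷ _)
fresh-length {X₁′ ∷ _} (() ∷ _)
fresh-length {Y′ ∷ _}  (() ∷ _)
fresh-length {Z′ ∷ _}  (() ∷ _)

fresh-live : ∀ A → fresh A ≡ true → live A ≡ true
fresh-live X₀ _ = refl
fresh-live X₁ _ = refl
fresh-live Y  _ = refl
fresh-live Z ()
fresh-live X₀′ ()
fresh-live X₁′ ()
fresh-live Y′ ()
fresh-live Z′ ()

module _ (n : ℕ) {l : List Letter} (l-fresh : Fresh l) where
  private
    w : List Letter
    w = l ʳ++ Z ∷ Z ∷ replicate n Z

  launch-zs : zs w ≡ 2 + n
  launch-zs = trans (count-ʳ++ (token y-phase) l)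
    (cong₂ _+_ (fresh-zs l-fresh) (cong (2 +_) (count-replicate (token y-phase) refl n)))

  launch-ys : ys w ≡ ys l
  launch-ys = trans (count-ʳ++ (target y-phase) l)
    (trans (cong (ys l +_) (count-replicate-false (target y-phase) refl n)) (+-identityʳ _))

  launch-xs : xs w ≡ xs l
  launch-xs = trans (count-ʳ++ (target x-phase) l)
    (trans (cong (xs l +_) (count-replicate-false (target x-phase) refl n)) (+-identityʳ _))

  launchable : ys l < 2 ^ (2 + n) → xs l < 2 ^ ys l → Launchable l w
  launchable ys< xs< =
    l-fresh , ʳ++⁺ (All.map (fresh-live _) l-fresh) (refl ∷ refl ∷ replicate⁺ n refl) ,
    subst₂ (λ y z → y < 2 ^ z) (sym launch-ys) (sym launch-zs) ys< ,
    subst₂ (λ x y → x < 2 ^ y) (sym launch-xs) (sym launch-ys) xs<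

-- Leaves only finitely many sources, which is what pumping will contradict.
launchable-length : ∀ n {l} → Launchable l (l ʳ++ Z ∷ Z ∷ replicate n Z) →
                    length l ≤ 2 ^ (2 + n) + 2 ^ 2 ^ (2 + n)
launchable-length n {l} (fr , _ , ys< , xs<) = begin
  length l                         ≡⟨ fresh-length fr ⟩
  ys l + xs l                      ≤⟨ +-mono-≤ (<⇒≤ ys<′) (<⇒≤ xs<′) ⟩
  2 ^ (2 + n) + 2 ^ ys l           ≤⟨ +-monoʳ-≤ (2 ^ (2 + n)) (^-monoʳ-≤ 2 (<⇒≤ ys<′)) ⟩
  2 ^ (2 + n) + 2 ^ 2 ^ (2 + n)    ∎
  where
  open ≤-Reasoning
  ys<′ : ys l < 2 ^ (2 + n)
  ys<′ = subst₂ (λ y z → y < 2 ^ z) (launch-ys n fr) (launch-zs n fr) ys<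
  xs<′ : xs l < 2 ^ ys l
  xs<′ = subst₂ (λ x y → x < 2 ^ y) (launch-xs n fr) (launch-ys n fr) xs<

bit : Fin 2 → Letter
bit 0F = X₀
bit 1F = X₁

bit-injective : ∀ {b c} → bit b ≡ bit c → b ≡ c
bit-injective {0F} {0F} _ = refl
bit-injective {1F} {1F} _ = refl
bit-injective {0F} {1F} ()
bit-injective {1F} {0F} ()

fresh-bit : ∀ b → fresh (bit b) ≡ true
fresh-bit 0F = refl
fresh-bit 1F = refl

ys-bit : ∀ b w → ys (bit b ∷ w) ≡ ys w
ys-bit 0F w = refl
ys-bit 1F w = refl

xs-bit : ∀ b w → xs (bit b ∷ w) ≡ suc (xs w)
xs-bit 0F w = refl
xs-bit 1F w = refl

-- The leading Xs are the binary digits of the index, most significant first; two kinds of X give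
-- exponentially many words in `k`.
xyWord : ∀ k (y : ℕ) → Fin (2 ^ k) → List Letter
xyWord zero    y _ = replicate y Y
xyWord (suc k) y i = let b , j = remQuot {2} (2 ^ k) i in bit b ∷ xyWord k y j

xyWord-injective : ∀ k y {i j} → xyWord k y i ≡ xyWord k y j → i ≡ j
xyWord-injective zero    y {0F} {0F} _ = refl
xyWord-injective (suc k) y {i} {j} eq =
  let b≡c , eq′ = ∷-injective eq in begin
  i                                             ≡⟨ combine-remQuot {2} (2 ^ k) i ⟨
  (let b , i′ = remQuot {2} (2 ^ k) i in combine b i′)
    ≡⟨ cong₂ combine (bit-injective b≡c) (xyWord-injective k y eq′) ⟩
  (let c , j′ = remQuot {2} (2 ^ k) j in combine c j′)
    ≡⟨ combine-remQuot {2} (2 ^ k) j ⟩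
  j                                             ∎
  where open ≡-Reasoning

xyWord-fresh : ∀ k y i → Fresh (xyWord k y i)
xyWord-fresh zero    y i = replicate⁺ y refl
xyWord-fresh (suc k) y i =
  let b , j = remQuot {2} (2 ^ k) i in fresh-bit b ∷ xyWord-fresh k y j

xyWord-ys : ∀ k y i → ys (xyWord k y i) ≡ y
xyWord-ys zero    y i = count-replicate (target y-phase) refl y
xyWord-ys (suc k) y i =
  let b , j = remQuot {2} (2 ^ k) i in trans (ys-bit b (xyWord k y j)) (xyWord-ys k y j)

xyWord-xs : ∀ k y i → xs (xyWord k y i) ≡ k
xyWord-xs zero    y i = count-replicate-false (target x-phase) refl y
xyWord-xs (suc k) y i =
  let b , j = remQuot {2} (2 ^ k) i in trans (xs-bit b (xyWord k y j)) (cong suc (xyWord-xs k y j))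

xyWord-trace : ∀ n k y i → y < 2 ^ (2 + n) → k < 2 ^ y →
               Trace G (headRight (xyWord k y i) unmarked []) (traceWord n)
xyWord-trace n k y i y< k< = trace-intro n (xyWord k y i) (launchable n (xyWord-fresh k y i)
  (subst (_< 2 ^ (2 + n)) (sym (xyWord-ys k y i)) y<)
  (subst₂ (λ x y → x < 2 ^ y) (sym (xyWord-xs k y i)) (sym (xyWord-ys k y i)) k<))

-- The counting argument

traceAutomaton-size : ∀ {s g} (T : Fin s → Transducer g) c → (∀ a → Transducer.states (T a) ≤ c) →
                      ∀ w → Automaton.size (traceAutomaton T w) ≤ 2 ^ (c * length w)
traceAutomaton-size T c states≤c []      = m^n>0 2 (c * 0)
traceAutomaton-size T c states≤c (a ∷ w) = begin
  Transducer.states (T a) * Automaton.size (traceAutomaton T w)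
    -- The factor `c` is enlarged to `2 ^ c` to keep the bound a power of two.
    ≤⟨ *-mono-≤ (≤-trans (states≤c a) (<⇒≤ (m<2^m c))) (traceAutomaton-size T c states≤c w) ⟩
  2 ^ c * 2 ^ (c * length w)  ≡⟨ ^-distribˡ-+-* 2 c (c * length w) ⟨
  2 ^ (c + c * length w)      ≡⟨ cong (2 ^_) (*-suc c (length w)) ⟨
  2 ^ (c * suc (length w))    ∎
  where open ≤-Reasoning

length-traceWord : ∀ n → length (traceWord n) ≡ 2 + n
length-traceWord n = cong suc (begin
  length (replicate n tally ++ [ launch ])     ≡⟨ length-++ (replicate n tally) ⟩
  length (replicate n tally) + 1               ≡⟨ +-comm _ 1 ⟩
  suc (length (replicate n tally))             ≡⟨ cong suc (length-replicate n) ⟩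
  suc n                                        ∎)
  where open ≡-Reasoning

-- Gives room for the number of Ys used below. The left side is at most `d * (2 + n)`, twice the
-- product of `d` and `suc d`, and neither of these exceeds `2 ^ d`.
linear-below-exponential : ∀ g c → let d = 2 + g + c ; n = d + d in
                           2 + (g + c * (2 + n)) < 2 ^ (2 + n)
linear-below-exponential g c = begin-strict
  2 + (g + c * (2 + n))             ≡⟨ +-assoc 2 g _ ⟨
  2 + g + c * (2 + n)               ≤⟨ +-monoˡ-≤ (c * (2 + n)) (m≤m*n (2 + g) (2 + n)) ⟩
  (2 + g) * (2 + n) + c * (2 + n)   ≡⟨ *-distribʳ-+ (2 + n) (2 + g) c ⟨
  d * (2 + n)                       ≡⟨ cong (λ k → d * suc k) (+-suc d d) ⟨
  d * (suc d + suc d)               ≤⟨ *-monoʳ-≤ d (+-mono-≤ (m<2^m d) (m<2^m d)) ⟩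
  d * (2 ^ d + 2 ^ d)               ≡⟨ cong (λ k → d * (2 ^ d + k)) (+-identityʳ (2 ^ d)) ⟨
  d * 2 ^ suc d                     <⟨ *-monoˡ-< (2 ^ suc d) {{m^n≢0 2 (suc d)}} (m<2^m d) ⟩
  2 ^ d * 2 ^ suc d                 ≡⟨ ^-distribˡ-+-* 2 d (suc d) ⟨
  2 ^ (d + suc d)                   ≡⟨ cong (2 ^_) (+-suc d d) ⟩
  2 ^ suc n                         ≤⟨ ^-monoʳ-≤ 2 (n≤1+n (suc n)) ⟩
  2 ^ (2 + n)                       ∎
  where
  open ≤-Reasoning
  d = 2 + g + c
  n = d + d

module NotRational {g} (T : Fin 3 → Transducer g) (G≅H : Isomorphic G (rationalGraph T)) where
  open Transducer

  c n e y k : ℕ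
  -- The sum bounds each of the three state counts. Then `2 ^ e` bounds `g * size`, so that
  -- `k < 2 ^ y`, while `n` is large enough for `y < 2 ^ (2 + n)`.
  c = states (T mark) + (states (T tally) + states (T launch))
  n = 2 + g + c + (2 + g + c)
  e = g + c * (2 + n)
  y = 2 + e

  open Automaton (traceAutomaton T (traceWord n)) using (size; Recognizes; pumping)

  -- At most `2 ^ (g * size)` words have length at most `size`, and `2 ^ k` is twice that.
  k = suc (g * size)

  states≤c : ∀ a → states (T a) ≤ c
  states≤c mark   = m≤m+n _ _
  states≤c tally  = ≤-trans (m≤m+n _ _) (m≤n+m _ (states (T mark)))
  states≤c launch = ≤-trans (m≤n+m _ (states (T tally))) (m≤n+m _ (states (T mark)))

  k<2^y : k < 2 ^ y
  k<2^y = begin-strict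
    suc (g * size)
      ≤⟨ s≤s (*-mono-≤ (<⇒≤ (m<2^m g)) (traceAutomaton-size T c states≤c (traceWord n))) ⟩
    suc (2 ^ g * 2 ^ (c * length (traceWord n)))
      ≡⟨ cong (λ m → suc (2 ^ g * 2 ^ (c * m))) (length-traceWord n) ⟩
    suc (2 ^ g * 2 ^ (c * (2 + n)))    ≡⟨ cong suc (^-distribˡ-+-* 2 g (c * (2 + n))) ⟨
    suc (2 ^ e)                        ≤⟨ +-monoˡ-≤ (2 ^ e) (m^n>0 2 e) ⟩
    2 ^ e + 2 ^ e                      ≡⟨ cong (2 ^ e +_) (+-identityʳ (2 ^ e)) ⟨
    2 ^ suc e                          <⟨ ^-monoʳ-< 2 (s≤s (s≤s z≤n)) (n<1+n (suc e)) ⟩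
    2 ^ y                              ∎
    where open ≤-Reasoning

  G-source : Fin (2 ^ k) → Σ (Graph.V G) λ x → Trace G x (traceWord n)
  G-source i = _ , xyWord-trace n k y i (linear-below-exponential g c) k<2^y

  H-source : Fin (2 ^ k) → Σ (List (Fin g)) λ u → Trace (rationalGraph T) u (traceWord n)
  H-source i = traceSource-from G≅H mark _ (G-source i)

  H-source-injective : Injective _≡_ _≡_ (λ i → proj₁ (H-source i))
  H-source-injective {i} {j} eq = xyWord-injective k y (proj₁ (headRight-injective
    {xyWord k y i} {unmarked} {[]} {xyWord k y j} {unmarked} {[]}
    (traceSource-from-injective G≅H mark _ {G-source i} {G-source j} eq)))

  not-all-short : ¬ (∀ i → length (proj₁ (H-source i)) ≤ size)
  not-all-short short = <⇒≱ (^-monoʳ-< 2 (s≤s (s≤s z≤n)) (n<1+n (g * size))) (begin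
    2 ^ k            ≤⟨ countShortLists size (λ i → proj₁ (H-source i)) H-source-injective short ⟩
    suc g ^ size     ≤⟨ ^-monoˡ-≤ size (m<2^m g) ⟩
    (2 ^ g) ^ size   ≡⟨ ^-*-assoc 2 g size ⟩
    2 ^ (g * size)   ∎)
    where open ≤-Reasoning

  -- Pumping a long word would give infinitely many sources, which the isomorphism would carry to
  -- infinitely many distinct words of length at most `bound`.
  not-long : ∀ i → ¬ size ≤ length (proj₁ (H-source i))
  -- Over eight letters there are at most `9 ^ bound` such words, so `suc (9 ^ bound)` pumped words
  -- are already too many.
  not-long i long = <⇒≱ (n<1+n (9 ^ bound))
    (countShortLists bound (λ j → l (toℕ j)) (λ eq → toℕ-injective (l-injective eq))
      (λ j → launchable-length n (proj₂ (proj₂ (view (toℕ j))))))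
    where
    bound : ℕ
    bound = 2 ^ (2 + n) + 2 ^ 2 ^ (2 + n)

    pumped = pumping (Equivalence.from (traceAutomaton-recognizes T (traceWord n)) (proj₂ (H-source i))) long

    word : ℕ → Σ (List (Fin g)) λ u → Trace (rationalGraph T) u (traceWord n)
    word j = proj₁ pumped j ,
             Equivalence.to (traceAutomaton-recognizes T (traceWord n)) (proj₂ (proj₂ pumped) j)

    image : ℕ → Σ (Graph.V G) λ x → Trace G x (traceWord n)
    image j = traceSource-to G≅H mark _ (word j)

    view : ∀ j → ∃[ l ] proj₁ (image j) ≡ headRight l unmarked [] ×
                        Launchable l (l ʳ++ Z ∷ Z ∷ replicate n Z)
    view j = trace-view n (proj₂ (image j))

    l : ℕ → List Letter
    l j = proj₁ (view j)

    l-injective : Injective _≡_ _≡_ l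
    l-injective {i} {j} eq = proj₁ (proj₂ pumped) {i} {j}
      (traceSource-to-injective {G = G} {rationalGraph T} G≅H mark (replicate n tally ++ [ launch ])
        {word i} {word j}
      (trans (proj₁ (proj₂ (view i))) (trans (cong (λ l → headRight l unmarked []) eq)
        (sym (proj₁ (proj₂ (view j)))))))

  absurd : ⊥
  absurd = not-all-short (λ i → ≰⇒≥ (not-long i))

theorem6 : ∃[ s ] Σ (Graph s) λ G → IsLinearlyBounded G × BoundedDegree G × ¬ IsRational G
theorem6 = 3 , G , (normalized , isomorphic-refl G) , G-boundedDegree ,
           λ (_ , T , G≅H) → NotRational.absurd T G≅H
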